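{- Fix an integer $k\ge1$. For each integer $n\ge1$, let $p_k(n)$ denote the probability that a (uniformly random) $k$-tuple of functions between $k$ sets $X_1,\dots,X_k$ of cardinality $|X_i|=n$ is eventually constant. Then $$p_k(n)=1-\left(1-\frac1n\right)^k.$$ It follows that, as $n\to\infty$, $$p_k(n)=\frac kn+\mathcal O\left(\frac1{n^2}\right).$$
   Context: The sets $X_1,\dots,X_k$ are pairwise disjoint, indices are modulo $k$, and a $k$-tuple of functions means $(f_1,\dots,f_k)$ with $f_i:X_i\to X_{i+1}$ ($X_{k+1}=X_1$); there are $n^{kn}$ such tuples and $p_k(n)$ is the proportion that are eventually constant. The tuple is eventually constant if $(f_k\cdots f_1)^m:X_1\to X_1$ is constant for some $m\ge1$. -}

module Defs where

open import Level using (Level)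
open import Data.Nat.Base as ℕ using (ℕ; zero; suc; NonZero; _≤_; s≤s; z≤n)
import Data.Nat.Properties as ℕ
open import Data.Integer.Base using (+_)
open import Data.Rational.Base as ℚ using (ℚ; _/_; ∣_∣; _-_; _*_; _+_; 1ℚ; +-*-rawSemiring)
open import Data.Fin.Base as Fin
  using (Fin; zero; suc; inject₁; fromℕ; fold′; toℕ; combine; remQuot; finToFun; funToFin)
import Data.Fin.Properties as Fin
open import Data.Fin.Relation.Unary.Top using (view; ‵fromℕ; ‵inject₁; view-fromℕ; view-inject₁)
open import Data.List.Base using (List; length; filter; map; allFin)
open import Data.Product.Base using (∃; ∃-syntax; _×_; _,_; proj₁; proj₂)
open import Function.Base using (_∘_)
open import Function.Bundles using (_↔_; module Inverse)
open import Function.Construct.Symmetry using (↔-sym)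
open import Function.Properties.Inverse using (↔⇒↣)
import Function.Endo.Propositional as Endo
open import Relation.Nullary.Decidable using (Dec; map′; via-injection)
open import Relation.Binary.Definitions using (DecidableEquality)
open import Relation.Binary.PropositionalEquality
  using (_≡_; _≗_; refl; sym; trans; cong; cong₂; cong-app; subst; module ≡-Reasoning)
open import Algebra.Definitions.RawSemiring +-*-rawSemiring public using (_^_)

private
  variable
    ℓ : Level
    k n : ℕ

-- The sets X₁, …, Xₖ₊₁ are the members X 0, …, X k of a family of types.
-- As a dependent family they are tagged by their index, hence disjoint.
-- Here k + 1 ≥ 1 is the number of sets.

record Tuple {k} (X : Fin (suc k) → Set ℓ) : Set ℓ where
  field
    arc   : ∀ i → X (inject₁ i) → X (suc i)
    -- the last function, whose target index wraps around
    close : X (fromℕ k) → X zero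

  -- fₖ₊₁ ∘ ⋯ ∘ f₁
  composite : X zero → X zero
  composite x = close (fold′ X arc x (fromℕ k))

open Tuple public

Constant : {A B : Set ℓ} → (A → B) → Set ℓ
Constant f = ∀ x y → f x ≡ f y

SomePowerConstant : {A : Set ℓ} → (A → A) → Set ℓ
SomePowerConstant {A = A} g = ∃[ m ] 1 ≤ m × Constant (g ^ᵉ m)
  where open Endo A using () renaming (_^_ to _^ᵉ_)

EventuallyConstant : {X : Fin (suc k) → Set ℓ} → Tuple X → Set ℓ
EventuallyConstant t = SomePowerConstant (composite t)

-- On a set with n elements it suffices to look at the power n + 1.

module _ {A : Set ℓ} (g : A → A) where

  private
    module E = Endo A
    open E using () renaming (_^_ to _^ᵉ_)

    split : ∀ a b x → (g ^ᵉ (a ℕ.+ b)) x ≡ (g ^ᵉ a) ((g ^ᵉ b) x)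
    split a b = cong-app (E.^-homo g a b)

    swap : ∀ a b x → (g ^ᵉ a) ((g ^ᵉ b) x) ≡ (g ^ᵉ b) ((g ^ᵉ a) x)
    swap a b x = trans (sym (split a b x))
      (trans (cong (λ m → (g ^ᵉ m) x) (ℕ.+-comm a b)) (split b a x))

    period : ∀ d z → (g ^ᵉ d) z ≡ z → ∀ m → (g ^ᵉ (m ℕ.* d)) z ≡ z
    period d z fix zero    = refl
    period d z fix (suc m) = trans (split d (m ℕ.* d) z)
      (trans (cong (g ^ᵉ d) (period d z fix m)) fix)

  somePower⇒power : Fin n ↔ A → SomePowerConstant g → Constant (g ^ᵉ suc n)
  somePower⇒power {n} e (m , _ , const) x y = trans (limit x) (trans (const x y) (sym (limit y)))
    where
    open Inverse e using (to; from; strictlyInverseˡ)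
    from-injective : ∀ {u v} → from u ≡ from v → u ≡ v
    from-injective {u} {v} eq =
      trans (sym (strictlyInverseˡ u)) (trans (cong to eq) (strictlyInverseˡ v))

    limit : ∀ w → (g ^ᵉ suc n) w ≡ (g ^ᵉ m) w
    limit w with i , j , i<j , eq ← Fin.pigeonhole (ℕ.n<1+n n) (λ i → from ((g ^ᵉ toℕ i) w)) = begin
      (g ^ᵉ suc n) w   ≡⟨ cong (λ r → (g ^ᵉ r) w) (sym (ℕ.m∸n+n≡m (ℕ.<⇒≤ (Fin.toℕ<n i)))) ⟩
      (g ^ᵉ (r ℕ.+ a)) w ≡⟨ split r a w ⟩
      (g ^ᵉ r) z       ≡⟨ cong (g ^ᵉ r) z≡c ⟩
      (g ^ᵉ r) ((g ^ᵉ m) w) ≡⟨ swap r m w ⟩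
      (g ^ᵉ m) ((g ^ᵉ r) w) ≡⟨ const _ _ ⟩
      (g ^ᵉ m) w       ∎
      where
      open ≡-Reasoning
      a = toℕ i
      r = suc n ℕ.∸ a
      d = toℕ j ℕ.∸ suc a
      z = (g ^ᵉ a) w
      d+a : suc d ℕ.+ a ≡ toℕ j
      d+a = trans (sym (ℕ.+-suc d a)) (ℕ.m∸n+n≡m i<j)
      fix : (g ^ᵉ suc d) z ≡ z
      fix = trans (sym (split (suc d) a w))
        (trans (cong (λ b → (g ^ᵉ b) w) d+a) (sym (from-injective eq)))
      z≡c : z ≡ (g ^ᵉ m) w
      z≡c = begin
        z                                ≡⟨ sym (period (suc d) z fix m) ⟩
        (g ^ᵉ (m ℕ.* suc d)) z           ≡⟨ cong (λ b → (g ^ᵉ b) z) (ℕ.*-suc m d) ⟩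
        (g ^ᵉ (m ℕ.+ m ℕ.* d)) z         ≡⟨ split m (m ℕ.* d) z ⟩
        (g ^ᵉ m) ((g ^ᵉ (m ℕ.* d)) z)    ≡⟨ const _ _ ⟩
        (g ^ᵉ m) w                       ∎

  somePowerConstant? : Fin n ↔ A → Dec (SomePowerConstant g)
  somePowerConstant? {n} e =
    map′ (λ c → suc n , s≤s z≤n , λ x y →
            trans (cong (g ^ᵉ suc n) (sym (strictlyInverseˡ x)))
              (trans (c (from x) (from y)) (cong (g ^ᵉ suc n) (strictlyInverseˡ y))))
         (λ s i j → somePower⇒power e s (to i) (to j))
         (Fin.all? λ i → Fin.all? λ j → (g ^ᵉ suc n) (to i) ≟ (g ^ᵉ suc n) (to j))
    where
    open Inverse e using (to; from; strictlyInverseˡ)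
    _≟_ : DecidableEquality A
    _≟_ = via-injection (↔⇒↣ (↔-sym e)) Fin._≟_

module _ {X : Fin (suc k) → Set ℓ} (e : ∀ i → Fin n ↔ X i) where

  private
    module e i = Inverse (e i)

  eventuallyConstant? : (t : Tuple X) → Dec (EventuallyConstant t)
  eventuallyConstant? t = somePowerConstant? (composite t) (e zero)

  -- A code is the concatenation of the k + 1 tables of values, each of length n.
  decode : Fin (n ℕ.^ (suc k ℕ.* n)) → Tuple X
  decode c .arc i x = e.to (suc i) (finToFun c (combine (inject₁ i) (e.from (inject₁ i) x)))
  decode c .close x = e.to zero (finToFun c (combine (fromℕ k) (e.from (fromℕ k) x)))

  allTuples : List (Tuple X)
  allTuples = map decode (allFin _)

  -- The probability, for the uniform distribution, of being eventually constant.
  probability : .{{_ : NonZero n}} → ℚ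
  probability = _/_ (+ length (filter eventuallyConstant? allTuples)) (n ℕ.^ (suc k ℕ.* n))
                    {{ℕ.m^n≢0 n (suc k ℕ.* n)}}

  -- The two facts below show that allTuples lists every tuple exactly once,
  -- tuples being compared pointwise.

  _≋_ : Tuple X → Tuple X → Set ℓ
  s ≋ t = (∀ i x → arc s i x ≡ arc t i x) × (∀ x → close s x ≡ close t x)

  decode-surjective : ∀ t → ∃[ c ] decode c ≋ t
  decode-surjective t = funToFin values , arcs , closes
    where
    row : (i : Fin (suc k)) → Fin n → Fin n
    row i y with view i
    ... | ‵fromℕ     = e.from zero (close t (e.to (fromℕ k) y))
    ... | ‵inject₁ j = e.from (suc j) (arc t j (e.to (inject₁ j) y))

    values : Fin (suc k ℕ.* n) → Fin n
    values p = row (proj₁ (remQuot n p)) (proj₂ (remQuot {suc k} n p))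

    values-combine : ∀ i y → finToFun (funToFin values) (combine i y) ≡ row i y
    values-combine i y = trans (Fin.finToFun-funToFin values (combine i y))
      (cong (λ q → row (proj₁ q) (proj₂ q)) (Fin.remQuot-combine {suc k} i y))

    arcs : ∀ i x → arc (decode (funToFin values)) i x ≡ arc t i x
    arcs i x rewrite values-combine (inject₁ i) (e.from (inject₁ i) x) | view-inject₁ i =
      trans (e.strictlyInverseˡ (suc i) _) (cong (arc t i) (e.strictlyInverseˡ (inject₁ i) x))

    closes : ∀ x → close (decode (funToFin values)) x ≡ close t x
    closes x rewrite values-combine (fromℕ k) (e.from (fromℕ k) x) | view-fromℕ k =
      trans (e.strictlyInverseˡ zero _) (cong (close t) (e.strictlyInverseˡ (fromℕ k) x))

  decode-injective : ∀ c d → decode c ≋ decode d → c ≡ d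
  decode-injective c d (arcs , closes) =
    trans (sym (Fin.funToFin-finToFin {suc k ℕ.* n} {n} c))
      (trans (funToFin-cong same) (Fin.funToFin-finToFin {suc k ℕ.* n} {n} d))
    where
    funToFin-cong : ∀ {a b} {f g : Fin a → Fin b} → f ≗ g → funToFin f ≡ funToFin g
    funToFin-cong {zero}  f≗g = refl
    funToFin-cong {suc a} f≗g = cong₂ combine (f≗g zero) (funToFin-cong (f≗g ∘ suc))

    to-injective : ∀ i {u v} → e.to i u ≡ e.to i v → u ≡ v
    to-injective i {u} {v} eq =
      trans (sym (e.strictlyInverseʳ i u)) (trans (cong (e.from i) eq) (e.strictlyInverseʳ i v))

    sameRow : ∀ (i : Fin (suc k)) y → finToFun c (combine i y) ≡ finToFun d (combine i y)
    sameRow i y with view i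
    ... | ‵fromℕ     = subst (λ z → finToFun c (combine (fromℕ k) z) ≡ finToFun d (combine (fromℕ k) z))
                         (e.strictlyInverseʳ _ y) (to-injective _ (closes (e.to _ y)))
    ... | ‵inject₁ j = subst (λ z → finToFun c (combine (inject₁ j) z) ≡ finToFun d (combine (inject₁ j) z))
                         (e.strictlyInverseʳ _ y) (to-injective _ (arcs j (e.to _ y)))

    same : finToFun c ≗ finToFun d
    same p = subst (λ q → finToFun c q ≡ finToFun d q) (Fin.combine-remQuot {suc k} n p)
      (sameRow (proj₁ (remQuot {suc k} n p)) (proj₂ (remQuot {suc k} n p)))

PositiveSequence : Set
PositiveSequence = (n : ℕ) .{{_ : NonZero n}} → ℚ

-- f = g + 𝒪(h) as n → ∞.  A rational constant C loses nothing: a real one can be rounded up.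
_≈_+𝒪_ : PositiveSequence → PositiveSequence → PositiveSequence → Set
f ≈ g +𝒪 h = ∃[ C ] ∃[ N ] ∀ n .{{_ : NonZero n}} → N ≤ n → ∣ f n - g n ∣ ℚ.≤ C * ∣ h n ∣

{-# OPTIONS --safe #-}

-- Let g = h ∘ f with f : X → Y uniformly random and h : Y → X fixed.  Weighting x ∈ X by the size of
-- its fibre under h, Cayley's formula for weighted rooted trees gives the number of f for which g
-- flows into a fixed point r; summing over r, the probability that g is eventually constant is the
-- probability that h identifies two independent uniformly random points of Y.  For
-- h = fₖ ∘ ⋯ ∘ f₂ two random points are distinct with probability 1 - 1/n and then stay distinct
-- under each of the k - 1 maps with probability 1 - 1/n, independently.  Hence p = 1 - (1 - 1/n)ᵏ.
-- The error dₖ = (1 - x)ᵏ - (1 - k x) satisfies dₖ₊₁ = (1 - x) dₖ + k x², so 0 ≤ dₖ = 𝒪(x²).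

module Submission where

open import Defs
open import Level using (Level)
open import Algebra.Bundles using (CommutativeRing)
open import Data.Bool.Base using (if_then_else_)
open import Data.Fin.Base as Fin
  using (Fin; zero; suc; inject₁; fromℕ; fold′; combine; finToFun; punchIn; punchOut; _↑ˡ_; _↑ʳ_)
import Data.Fin.Properties as Fin
import Data.Integer.Base as ℤ
import Data.Integer.Properties as ℤ
open import Data.List.Base as List
  using (List; []; _∷_; _++_; length; filter; allFin; cartesianProductWith)
import Data.List.Properties as List
open import Data.Nat.Base as ℕ using (ℕ; zero; suc; _+_; _*_; _∸_; _⊔_; _≤_; s≤s; z≤n; NonZero)
open import Data.Nat.Properties
open import Data.Nat.Tactic.RingSolver using (solve-∀)
open import Data.Product.Base using (∃-syntax; _×_; _,_; proj₁; proj₂)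
open import Data.Rational.Base as ℚ using (ℚ; _/_; _-_; 0ℚ; 1ℚ; ∣_∣)
import Data.Rational.Properties as ℚ
open import Data.Rational.Solver using (module +-*-Solver)
open import Data.Rational.Unnormalised.Base as ℚᵘ using (mkℚᵘ; *≡*)
import Data.Rational.Unnormalised.Properties as ℚᵘ
open import Data.Vec.Base as Vec using (Vec; []; _∷_; lookup; insertAt; tabulate)
import Data.Vec.Properties as Vec
open import Function.Base using (_∘_; id; it)
open import Function.Bundles using (_↔_; module Inverse)
open import Function.Construct.Identity using (↔-id)
import Function.Endo.Propositional as Endo
open import Relation.Binary.PropositionalEquality
open import Relation.Nullary.Decidable using (Dec; yes; no; does; map′; ¬?)
open import Relation.Nullary.Negation using (¬_; contradiction)
open import Algebra.Properties.CommutativeSemiring.Exp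
  (CommutativeRing.commutativeSemiring ℚ.+-*-commutativeRing) using (^-distrib-*)
open ≡-Reasoning

private
  variable
    a b c ℓ : Level
    A : Set a
    B : Set b
    C : Set c

-- Sums over lists

∑ : List A → (A → ℕ) → ℕ
∑ []       f = 0
∑ (x ∷ xs) f = f x + ∑ xs f

syntax ∑ xs (λ x → e) = ∑[ x ← xs ] e

∑-cong : ∀ (xs : List A) {f g : A → ℕ} → f ≗ g → ∑ xs f ≡ ∑ xs g
∑-cong []       f≗g = refl
∑-cong (x ∷ xs) f≗g = cong₂ _+_ (f≗g x) (∑-cong xs f≗g)

∑-distrib-+ : ∀ (xs : List A) (f g : A → ℕ) → ∑[ x ← xs ] (f x + g x) ≡ ∑ xs f + ∑ xs g
∑-distrib-+ []       f g = refl
∑-distrib-+ (x ∷ xs) f g rewrite ∑-distrib-+ xs f g = interchange (f x) (g x) (∑ xs f) (∑ xs g)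
  where
  interchange : ∀ s t u v → s + t + (u + v) ≡ s + u + (t + v)
  interchange = solve-∀

*-distribʳ-∑ : ∀ (xs : List A) (f : A → ℕ) m → ∑ xs f * m ≡ ∑[ x ← xs ] (f x * m)
*-distribʳ-∑ []       f m = refl
*-distribʳ-∑ (x ∷ xs) f m = trans (*-distribʳ-+ m (f x) (∑ xs f)) (cong (f x * m +_) (*-distribʳ-∑ xs f m))

*-distribˡ-∑ : ∀ (xs : List A) (f : A → ℕ) m → m * ∑ xs f ≡ ∑[ x ← xs ] (m * f x)
*-distribˡ-∑ xs f m = trans (*-comm m (∑ xs f))
  (trans (*-distribʳ-∑ xs f m) (∑-cong xs λ x → *-comm (f x) m))

∑-const : ∀ (xs : List A) m → ∑[ _ ← xs ] m ≡ length xs * m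
∑-const []       m = refl
∑-const (x ∷ xs) m = cong (m +_) (∑-const xs m)

∑-zero : ∀ (xs : List A) → ∑[ _ ← xs ] 0 ≡ 0
∑-zero xs = trans (∑-const xs 0) (*-zeroʳ (length xs))

∑-comm : ∀ (xs : List A) (ys : List B) (f : A → B → ℕ) →
         ∑[ x ← xs ] (∑[ y ← ys ] f x y) ≡ ∑[ y ← ys ] (∑[ x ← xs ] f x y)
∑-comm []       ys f = sym (∑-zero ys)
∑-comm (x ∷ xs) ys f = trans (cong (∑ ys (f x) +_) (∑-comm xs ys f))
  (sym (∑-distrib-+ ys (f x) λ y → ∑[ x ← xs ] f x y))

∑-++ : ∀ (xs ys : List A) (f : A → ℕ) → ∑ (xs ++ ys) f ≡ ∑ xs f + ∑ ys f
∑-++ []       ys f = refl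
∑-++ (x ∷ xs) ys f = trans (cong (f x +_) (∑-++ xs ys f)) (sym (+-assoc (f x) _ _))

∑-map : ∀ (g : A → B) (xs : List A) (f : B → ℕ) → ∑ (List.map g xs) f ≡ ∑ xs (f ∘ g)
∑-map g []       f = refl
∑-map g (x ∷ xs) f = cong (f (g x) +_) (∑-map g xs f)

∑-cartesianProductWith : ∀ (_∙_ : A → B → C) xs ys (f : C → ℕ) →
  ∑ (cartesianProductWith _∙_ xs ys) f ≡ ∑[ x ← xs ] (∑[ y ← ys ] f (x ∙ y))
∑-cartesianProductWith _∙_ []       ys f = refl
∑-cartesianProductWith _∙_ (x ∷ xs) ys f = trans (∑-++ (List.map (x ∙_) ys) _ f)
  (cong₂ _+_ (∑-map (x ∙_) ys f) (∑-cartesianProductWith _∙_ xs ys f))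

∑-allFin-suc : ∀ {n} (f : Fin (suc n) → ℕ) → ∑ (allFin (suc n)) f ≡ f zero + ∑ (allFin n) (f ∘ suc)
∑-allFin-suc {n} f = cong (f zero +_)
  (trans (cong (λ xs → ∑ xs f) (sym (List.map-tabulate id suc))) (∑-map suc (allFin n) f))

-- Splitting off the term at `i` leaves a sum over the points different from `i`; this is how the
-- diagonal of a double sum is isolated later.
∑-allFin-punchIn : ∀ {n} (i : Fin (suc n)) (f : Fin (suc n) → ℕ) →
                   ∑ (allFin (suc n)) f ≡ f i + ∑[ j ← allFin n ] f (punchIn i j)
∑-allFin-punchIn         zero    f = ∑-allFin-suc f
∑-allFin-punchIn {suc n} (suc i) f = begin
  ∑ (allFin (2 + n)) f
    ≡⟨ ∑-allFin-suc f ⟩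
  f zero + ∑ (allFin (suc n)) (f ∘ suc)
    ≡⟨ cong (f zero +_) (∑-allFin-punchIn i (f ∘ suc)) ⟩
  f zero + (f (suc i) + ∑[ j ← allFin n ] f (suc (punchIn i j)))
    ≡⟨ swap (f zero) (f (suc i)) _ ⟩
  f (suc i) + (f zero + ∑[ j ← allFin n ] f (suc (punchIn i j)))
    ≡⟨ cong (f (suc i) +_) (∑-allFin-suc (f ∘ punchIn (suc i))) ⟨
  f (suc i) + ∑[ j ← allFin (suc n) ] f (punchIn (suc i) j) ∎
  where
  swap : ∀ s t u → s + (t + u) ≡ t + (s + u)
  swap = solve-∀

-- Indicators of decidable propositions

𝟙 : {P : Set ℓ} → Dec P → ℕ
𝟙 P? = if does P? then 1 else 0

𝟙-cong : {P : Set a} {Q : Set b} (P? : Dec P) (Q? : Dec Q) → (P → Q) → (Q → P) → 𝟙 P? ≡ 𝟙 Q?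
𝟙-cong (yes p) (yes q) to from = refl
𝟙-cong (yes p) (no ¬q) to from = contradiction (to p) ¬q
𝟙-cong (no ¬p) (yes q) to from = contradiction (from q) ¬p
𝟙-cong (no ¬p) (no ¬q) to from = refl

𝟙-true : {P : Set ℓ} (P? : Dec P) → P → 𝟙 P? ≡ 1
𝟙-true (yes _) p = refl
𝟙-true (no ¬p) p = contradiction p ¬p

𝟙-false : {P : Set ℓ} (P? : Dec P) → ¬ P → 𝟙 P? ≡ 0
𝟙-false (yes p) ¬p = contradiction p ¬p
𝟙-false (no _)  ¬p = refl

𝟙-¬ : {P : Set ℓ} (P? : Dec P) → 𝟙 P? + 𝟙 (¬? P?) ≡ 1
𝟙-¬ (yes _) = refl
𝟙-¬ (no _)  = refl

length-filter : ∀ {P : A → Set ℓ} (P? : ∀ x → Dec (P x)) xs → length (filter P? xs) ≡ ∑[ x ← xs ] 𝟙 (P? x)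
length-filter P? []       = refl
length-filter P? (x ∷ xs) with P? x
... | yes _ = cong suc (length-filter P? xs)
... | no _  = length-filter P? xs

∑-𝟙-≟ : ∀ {n} (i : Fin n) (f : Fin n → ℕ) → ∑[ j ← allFin n ] (𝟙 (i Fin.≟ j) * f j) ≡ f i
∑-𝟙-≟ {suc n} i f = begin
  ∑[ j ← allFin (suc n) ] (𝟙 (i Fin.≟ j) * f j)
    ≡⟨ ∑-allFin-punchIn i _ ⟩
  𝟙 (i Fin.≟ i) * f i + ∑[ j ← allFin n ] (𝟙 (i Fin.≟ punchIn i j) * f (punchIn i j))
    ≡⟨ cong₂ _+_ (cong (_* f i) (𝟙-true (i Fin.≟ i) refl))
         (∑-cong (allFin n) λ j → cong (_* f (punchIn i j))
           (𝟙-false (i Fin.≟ punchIn i j) (Fin.punchInᵢ≢i i j ∘ sym))) ⟩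
  1 * f i + ∑[ _ ← allFin n ] 0
    ≡⟨ cong₂ _+_ (*-identityˡ (f i)) (∑-zero (allFin n)) ⟩
  f i + 0
    ≡⟨ +-identityʳ (f i) ⟩
  f i ∎

-- Vectors with entries from a list

-- Functions out of an n-element set are enumerated as vectors, whose equality is structural, so
-- that no function extensionality arises.
vectors : List A → ∀ n → List (Vec A n)
vectors xs zero    = List.[ [] ]
vectors xs (suc n) = cartesianProductWith _∷_ xs (vectors xs n)

length-vectors : ∀ (xs : List A) n → length (vectors xs n) ≡ length xs ℕ.^ n
length-vectors xs zero    = refl
length-vectors xs (suc n) = begin
  length (vectors xs (suc n))               ≡⟨ *-identityʳ _ ⟨
  length (vectors xs (suc n)) * 1           ≡⟨ ∑-const (vectors xs (suc n)) 1 ⟨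
  ∑[ _ ← vectors xs (suc n) ] 1             ≡⟨ ∑-cartesianProductWith _∷_ xs (vectors xs n) _ ⟩
  ∑[ _ ← xs ] (∑[ _ ← vectors xs n ] 1)     ≡⟨ ∑-const xs _ ⟩
  length xs * (∑[ _ ← vectors xs n ] 1)     ≡⟨ cong (length xs *_)
                                                 (trans (∑-const (vectors xs n) 1) (*-identityʳ _)) ⟩
  length xs * length (vectors xs n)         ≡⟨ cong (length xs *_) (length-vectors xs n) ⟩
  length xs ℕ.^ suc n                         ∎

∑-vectors-suc : ∀ (xs : List A) n (f : Vec A (suc n) → ℕ) →
                ∑ (vectors xs (suc n)) f ≡ ∑[ x ← xs ] (∑[ v ← vectors xs n ] f (x ∷ v))
∑-vectors-suc xs n f = ∑-cartesianProductWith _∷_ xs (vectors xs n) f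

-- Fubini with coordinate `i` outermost instead of the first one, which allows conditioning on the
-- value at an arbitrary point.
∑-vectors-insertAt : ∀ (xs : List A) {n} (i : Fin (suc n)) (f : Vec A (suc n) → ℕ) →
  ∑ (vectors xs (suc n)) f ≡ ∑[ x ← xs ] (∑[ v ← vectors xs n ] f (insertAt v i x))
∑-vectors-insertAt xs         zero    f = ∑-vectors-suc xs _ f
∑-vectors-insertAt xs {suc n} (suc i) f = begin
  ∑ (vectors xs (2 + n)) f
    ≡⟨ ∑-vectors-suc xs (suc n) f ⟩
  ∑[ y ← xs ] (∑[ w ← vectors xs (suc n) ] f (y ∷ w))
    ≡⟨ ∑-cong xs (λ y → ∑-vectors-insertAt xs i (λ w → f (y ∷ w))) ⟩
  ∑[ y ← xs ] (∑[ x ← xs ] (∑[ v ← vectors xs n ] f (y ∷ insertAt v i x)))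
    ≡⟨ ∑-comm xs xs (λ y x → ∑[ v ← vectors xs n ] f (y ∷ insertAt v i x)) ⟩
  ∑[ x ← xs ] (∑[ y ← xs ] (∑[ v ← vectors xs n ] f (y ∷ insertAt v i x)))
    ≡⟨ ∑-cong xs (λ x → ∑-vectors-suc xs n (λ v → f (insertAt v (suc i) x))) ⟨
  ∑[ x ← xs ] (∑[ v ← vectors xs (suc n) ] f (insertAt v (suc i) x)) ∎

∑-vectors-++ : ∀ (xs : List A) m n (f : Vec A (m + n) → ℕ) →
  ∑ (vectors xs (m + n)) f ≡ ∑[ v ← vectors xs m ] (∑[ w ← vectors xs n ] f (v Vec.++ w))
∑-vectors-++ xs zero    n f = sym (+-identityʳ _)
∑-vectors-++ xs (suc m) n f = begin
  ∑ (vectors xs (suc m + n)) f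
    ≡⟨ ∑-vectors-suc xs (m + n) f ⟩
  ∑[ x ← xs ] (∑[ u ← vectors xs (m + n) ] f (x ∷ u))
    ≡⟨ ∑-cong xs (λ x → ∑-vectors-++ xs m n (λ u → f (x ∷ u))) ⟩
  ∑[ x ← xs ] (∑[ v ← vectors xs m ] (∑[ w ← vectors xs n ] f (x ∷ v Vec.++ w)))
    ≡⟨ ∑-vectors-suc xs m (λ v → ∑[ w ← vectors xs n ] f (v Vec.++ w)) ⟨
  ∑[ v ← vectors xs (suc m) ] (∑[ w ← vectors xs n ] f (v Vec.++ w)) ∎

-- Needed because a code stores all tables of a tuple in one flat vector, while the counting treats
-- the tables one at a time.
∑-vectors-concat : ∀ (xs : List A) m k (f : Vec A (k * m) → ℕ) →
  ∑ (vectors xs (k * m)) f ≡ ∑[ vs ← vectors (vectors xs m) k ] f (Vec.concat vs)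
∑-vectors-concat xs m zero    f = refl
∑-vectors-concat xs m (suc k) f = begin
  ∑ (vectors xs (m + k * m)) f
    ≡⟨ ∑-vectors-++ xs m (k * m) f ⟩
  ∑[ v ← vectors xs m ] (∑[ w ← vectors xs (k * m) ] f (v Vec.++ w))
    ≡⟨ ∑-cong (vectors xs m) (λ v → ∑-vectors-concat xs m k (λ w → f (v Vec.++ w))) ⟩
  ∑[ v ← vectors xs m ] (∑[ vs ← vectors (vectors xs m) k ] f (v Vec.++ Vec.concat vs))
    ≡⟨ ∑-vectors-suc (vectors xs m) k (f ∘ Vec.concat) ⟨
  ∑[ vs ← vectors (vectors xs m) (suc k) ] f (Vec.concat vs) ∎

-- Maps whose iterates bring every point to r

-- A finite path rather than an exponent, so that contraction and renumbering become inductions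
-- along the path. `step` is available at `r` as well, so a path may pass through `r` and return to
-- it.
data Reaches {A : Set a} (g : A → A) (r : A) : A → Set a where
  here : Reaches g r r
  step : ∀ {x} → Reaches g r (g x) → Reaches g r x

-- Only the non-root vertices choose a parent, hence `n` entries for `suc n` vertices; the root is
-- made a fixed point to keep the map total.
parent : ∀ {n} → Vec (Fin (suc n)) n → Fin (suc n) → Fin (suc n)
parent p zero    = zero
parent p (suc i) = lookup p i

IsTree : ∀ {n} → Vec (Fin (suc n)) n → Set
IsTree p = ∀ x → Reaches (parent p) zero x

-- Merges the vertex 1 into w and renumbers.
contract : ∀ {n} → Fin (suc n) → Fin (suc (suc n)) → Fin (suc n)
contract w zero          = zero
contract w (suc zero)    = w
contract w (suc (suc i)) = suc i

module _ {n} (w : Fin (suc n)) (p : Vec (Fin (suc (suc n))) n) where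

  private
    one : Fin (suc (suc n))
    one = suc zero
    g  = parent (punchIn one w ∷ p)
    g′ = parent (Vec.map (contract w) p)

    contract-punchIn : ∀ y → contract w (punchIn one y) ≡ y
    contract-punchIn zero    = refl
    contract-punchIn (suc y) = refl

    contract-reaches : ∀ {x} → Reaches g zero x → Reaches g′ zero (contract w x)
    contract-reaches here = here
    -- A step at the root stays at the root and is dropped.
    contract-reaches {zero}          (step q) = here
    -- The edge from 1 to its parent is the contracted one, so this step disappears.
    contract-reaches {suc zero}      (step q) = subst (Reaches g′ zero) (contract-punchIn w) (contract-reaches q)
    contract-reaches {suc (suc i)}   (step q) =
      step (subst (Reaches g′ zero) (sym (Vec.lookup-map i (contract w) p)) (contract-reaches q))

    -- `punchIn one` undoes `contract w` away from the vertex 1. At 1 the contraction gives `w`, and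
    -- one application of `g` leads from 1 to `punchIn one w`.
    lift : ∀ x → Reaches g zero (punchIn one (contract w x)) → Reaches g zero x
    lift zero          q = q
    lift (suc zero)    q = step q
    lift (suc (suc i)) q = q

    punchIn-reaches : ∀ {y} → Reaches g′ zero y → Reaches g zero (punchIn one y)
    punchIn-reaches here = here
    punchIn-reaches {zero}  (step q) = here
    punchIn-reaches {suc i} (step q) = step (lift _
      (subst (Reaches g zero ∘ punchIn one) (Vec.lookup-map i (contract w) p) (punchIn-reaches q)))

  -- Paths survive the contraction, and each vertex `y` of the smaller map is the image of
  -- `punchIn one y`, so none is missed.
  contract-tree : IsTree (punchIn (suc zero) w ∷ p) → IsTree (Vec.map (contract w) p)
  contract-tree t y = subst (Reaches g′ zero) (contract-punchIn y) (contract-reaches (t (punchIn one y)))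

  -- Paths of the contracted map lift; an entry that pointed to 1 costs one extra step through 1.
  expand-tree : IsTree (Vec.map (contract w) p) → IsTree (punchIn (suc zero) w ∷ p)
  expand-tree t x = lift x (punchIn-reaches (t (contract w x)))

-- The vertex 1 would be its own parent, so a path out of it could never end.
loop-not-tree : ∀ {n} (p : Vec (Fin (suc (suc n))) n) → ¬ IsTree (suc zero ∷ p)
loop-not-tree p t = go (t (suc zero))
  where
  go : ¬ Reaches (parent (suc zero ∷ p)) zero (suc zero)
  go (step q) = go q

-- Deciding by contraction makes the indicator of a tree compute to that of the contracted one,
-- since `map′` leaves `does` unchanged. The count below follows the same recursion.
tree? : ∀ {n} (p : Vec (Fin (suc n)) n) → Dec (IsTree p)
tree? []                = yes λ { zero → here }
tree? (zero ∷ p)        = map′ (expand-tree zero p) (contract-tree zero p) (tree? _)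
tree? (suc zero ∷ p)    = no (loop-not-tree p)
tree? (suc (suc i) ∷ p) = map′ (expand-tree (suc i) p) (contract-tree (suc i) p) (tree? _)

-- Weighted counts of rooted trees

fiber : ∀ {n} → List B → (B → Fin n) → Fin n → ℕ
fiber ys h x = ∑[ y ← ys ] 𝟙 (h y Fin.≟ x)

-- A vector of parents equals `Vec.map h f` for as many `f` as the product of the fibres over its
-- entries. So this is the sum over all trees of the product of the weights of the parents.
trees : ∀ {n} → List B → (B → Fin (suc n)) → ℕ
trees {n = n} ys h = ∑[ f ← vectors ys n ] 𝟙 (tree? (Vec.map h f))

-- The case where the parent of 1 is the root: the merged root inherits the weight of 1.
fiber-contract-zero : ∀ {n} (ys : List B) (h : B → Fin (suc (suc n))) →
  fiber ys (contract zero ∘ h) zero ≡ fiber ys h zero + fiber ys h (suc zero)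
fiber-contract-zero ys h = trans (∑-cong ys (λ y → split (h y))) (∑-distrib-+ ys _ _)
  where
  split : ∀ {n} (x : Fin (suc (suc n))) →
          𝟙 (contract zero x Fin.≟ zero) ≡ 𝟙 (x Fin.≟ zero) + 𝟙 (x Fin.≟ suc zero)
  split zero          = refl
  split (suc zero)    = refl
  split (suc (suc i)) = refl

-- The case where the parent of 1 is not the root: the weight of 1 goes to `suc i`, away from the
-- root.
fiber-contract-suc : ∀ {n} (ys : List B) (i : Fin n) (h : B → Fin (suc (suc n))) →
  fiber ys (contract (suc i) ∘ h) zero ≡ fiber ys h zero
fiber-contract-suc ys i h = ∑-cong ys (λ y → same (h y))
  where
  same : ∀ x → 𝟙 (contract (suc i) x Fin.≟ zero) ≡ 𝟙 (x Fin.≟ zero)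
  same zero          = refl
  same (suc zero)    = refl
  same (suc (suc i)) = refl

-- Cayley's formula with weights.  Conditioning on the parent of the vertex 1 and merging the two
-- leaves the total weight unchanged.
trees-count : ∀ n (ys : List B) (h : B → Fin (suc n)) →
              trees ys h * length ys ≡ fiber ys h zero * length ys ℕ.^ n
trees-count zero ys h = begin
  length ys + 0              ≡⟨ +-identityʳ (length ys) ⟩
  length ys                  ≡⟨ *-identityʳ (length ys) ⟨
  length ys * 1              ≡⟨ ∑-const ys 1 ⟨
  ∑[ _ ← ys ] 1              ≡⟨ ∑-cong ys (λ y → 𝟙-true (h y Fin.≟ zero) (trivial (h y))) ⟨
  fiber ys h zero            ≡⟨ *-identityʳ _ ⟨
  fiber ys h zero * 1        ∎
  where
  trivial : (x : Fin 1) → x ≡ zero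
  trivial zero = refl
-- After multiplication by `m`, a parent other than 0 and 1 accounts for `c₀ * N`, the root for
-- `(c₀ + c₁) * N` and a loop at 1 for nothing. The deficit `c₁ * (c₀ * N)` of the loops is added to
-- both sides to avoid subtraction; it equals the surplus `c₀ * (c₁ * N)` from the root.
trees-count (suc n) ys h = +-cancelʳ-≡ (c₁ * (c₀ * N)) _ _ (begin
  trees ys h * m + c₁ * (c₀ * N)
    ≡⟨ cong₂ _+_ (cong (_* m) (∑-vectors-suc ys n _)) (*-distribʳ-∑ ys _ (c₀ * N)) ⟩
  (∑[ y ← ys ] branch (h y)) * m + ∑[ y ← ys ] (𝟙 (h y Fin.≟ suc zero) * (c₀ * N))
    ≡⟨ cong₂ _+_ (*-distribʳ-∑ ys (branch ∘ h) m) refl ⟩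
  ∑[ y ← ys ] (branch (h y) * m) + ∑[ y ← ys ] (𝟙 (h y Fin.≟ suc zero) * (c₀ * N))
    ≡⟨ ∑-distrib-+ ys _ _ ⟨
  ∑[ y ← ys ] (branch (h y) * m + 𝟙 (h y Fin.≟ suc zero) * (c₀ * N))
    ≡⟨ ∑-cong ys (λ y → branch-count (h y)) ⟩
  ∑[ y ← ys ] (c₀ * N + 𝟙 (h y Fin.≟ zero) * (c₁ * N))
    ≡⟨ ∑-distrib-+ ys _ _ ⟩
  ∑[ _ ← ys ] (c₀ * N) + ∑[ y ← ys ] (𝟙 (h y Fin.≟ zero) * (c₁ * N))
    ≡⟨ cong₂ _+_ (∑-const ys (c₀ * N)) (sym (*-distribʳ-∑ ys _ (c₁ * N))) ⟩
  m * (c₀ * N) + c₀ * (c₁ * N)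
    ≡⟨ arrange m c₀ c₁ N ⟩
  c₀ * (m * N) + c₁ * (c₀ * N) ∎)
  where
  m  = length ys
  N  = m ℕ.^ n
  c₀ = fiber ys h zero
  c₁ = fiber ys h (suc zero)

  arrange : ∀ m c₀ c₁ N → m * (c₀ * N) + c₀ * (c₁ * N) ≡ c₀ * (m * N) + c₁ * (c₀ * N)
  arrange = solve-∀

  branch : Fin (suc (suc n)) → ℕ
  branch u = ∑[ f ← vectors ys n ] 𝟙 (tree? (u ∷ Vec.map h f))

  -- The contraction is absorbed into `h` while `ys` stays, so the induction hypothesis applies with
  -- the same total weight `m`.
  merged : ∀ w → (∑[ f ← vectors ys n ] 𝟙 (tree? (Vec.map (contract w) (Vec.map h f)))) * m
               ≡ fiber ys (contract w ∘ h) zero * N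
  merged w = trans
    (cong (_* m) (∑-cong (vectors ys n) (λ f → cong (𝟙 ∘ tree?) (sym (Vec.map-∘ (contract w) h f)))))
    (trees-count n ys (contract w ∘ h))

  branch-count : ∀ u → branch u * m + 𝟙 (u Fin.≟ suc zero) * (c₀ * N) ≡ c₀ * N + 𝟙 (u Fin.≟ zero) * (c₁ * N)
  branch-count zero = begin
    branch zero * m + 0                     ≡⟨ +-identityʳ _ ⟩
    branch zero * m                         ≡⟨ merged zero ⟩
    fiber ys (contract zero ∘ h) zero * N   ≡⟨ cong (_* N) (fiber-contract-zero ys h) ⟩
    (c₀ + c₁) * N                           ≡⟨ *-distribʳ-+ N c₀ c₁ ⟩
    c₀ * N + c₁ * N                         ≡⟨ cong (c₀ * N +_) (+-identityʳ (c₁ * N)) ⟨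
    c₀ * N + (c₁ * N + 0)                   ∎
  branch-count (suc zero) = begin
    branch (suc zero) * m + (c₀ * N + 0)
      -- `tree?` rejects a loop at 1 by computation, so every summand is 0.
      ≡⟨ cong (λ z → z * m + (c₀ * N + 0)) (∑-zero (vectors ys n)) ⟩
    c₀ * N + 0 ∎
  branch-count (suc (suc i)) = cong (_+ 0)
    (trans (merged (suc i)) (cong (_* N) (fiber-contract-suc ys i h)))

-- Eventually constant maps and trees

module _ {A : Set a} (g : A → A) where

  open Endo A using () renaming (_^_ to _^ᵉ_)

  ^ᵉ-suc : ∀ m x → (g ^ᵉ m) (g x) ≡ g ((g ^ᵉ m) x)
  ^ᵉ-suc zero    x = refl
  ^ᵉ-suc (suc m) x = cong g (^ᵉ-suc m x)

  ^ᵉ-fixed : ∀ {r} → g r ≡ r → ∀ m → (g ^ᵉ m) r ≡ r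
  ^ᵉ-fixed fix zero    = refl
  ^ᵉ-fixed fix (suc m) = trans (cong g (^ᵉ-fixed fix m)) fix

  reaches-^ᵉ : ∀ {r x} m → (g ^ᵉ m) x ≡ r → Reaches g r x
  reaches-^ᵉ         zero    refl = here
  reaches-^ᵉ {x = x} (suc m) eq   = step (reaches-^ᵉ m (trans (^ᵉ-suc m x) eq))

  depth : ∀ {r x} → Reaches g r x → ∃[ m ] (g ^ᵉ m) x ≡ r
  depth here                 = 0 , refl
  depth (step {x} q) with m , eq ← depth q = suc m , trans (sym (^ᵉ-suc m x)) eq

  fixed-unique : SomePowerConstant g → ∀ {r s} → g r ≡ r → g s ≡ s → r ≡ s
  fixed-unique (m , _ , const) {r} {s} fixʳ fixˢ =
    trans (sym (^ᵉ-fixed fixʳ m)) (trans (const r s) (^ᵉ-fixed fixˢ m))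

  -- A power of `g` commutes with `g`, so its constant value is fixed by `g`.
  fixed-exists : SomePowerConstant g → A → ∃[ r ] g r ≡ r
  fixed-exists (m , _ , const) x = (g ^ᵉ m) x , trans (sym (^ᵉ-suc m x)) (const (g x) x)

  somePowerConstant⇒reaches : ∀ {r} → g r ≡ r → SomePowerConstant g → ∀ x → Reaches g r x
  somePowerConstant⇒reaches {r} fix (m , _ , const) x = reaches-^ᵉ m (trans (const x r) (^ᵉ-fixed fix m))

bounded : ∀ {n} (f : Fin n → ℕ) → ∃[ m ] ∀ i → f i ≤ m
bounded {zero}  f = 0 , λ ()
bounded {suc n} f with m , f≤m ← bounded (f ∘ suc) =
  f zero ⊔ m , λ { zero → m≤m⊔n _ _ ; (suc i) → ≤-trans (f≤m i) (m≤n⊔m _ _) }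

-- Finitely many path lengths have a common bound `m`, and an orbit that has arrived at the fixed
-- point `r` stays there.
reaches⇒somePowerConstant : ∀ {n} (g : Fin n → Fin n) {r} → g r ≡ r → (∀ x → Reaches g r x) → SomePowerConstant g
reaches⇒somePowerConstant {n} g {r} fix reach with m , d≤m ← bounded (proj₁ ∘ depth g ∘ reach) =
  -- The exponent has to be positive, and the bound `m` may be 0.
  suc m , s≤s z≤n , λ x y → trans (limit x) (sym (limit y))
  where
  open Endo (Fin n) using (^-homo) renaming (_^_ to _^ᵉ_)
  limit : ∀ x → (g ^ᵉ suc m) x ≡ r
  limit x = trans (cong g (begin
    (g ^ᵉ m) x                     ≡⟨ cong (λ k → (g ^ᵉ k) x) (m∸n+n≡m (d≤m x)) ⟨
    (g ^ᵉ (m ∸ d + d)) x           ≡⟨ cong-app (^-homo g (m ∸ d) d) x ⟩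
    (g ^ᵉ (m ∸ d)) ((g ^ᵉ d) x)    ≡⟨ cong (g ^ᵉ (m ∸ d)) (proj₂ (depth g (reach x))) ⟩
    (g ^ᵉ (m ∸ d)) r               ≡⟨ ^ᵉ-fixed g fix (m ∸ d) ⟩
    r                              ∎)) fix
    where d = proj₁ (depth g (reach x))

-- Renumbers the points so that r becomes the root 0 of a tree.
reroot : ∀ {n} → Fin (suc n) → Fin (suc n) → Fin (suc n)
reroot r x with r Fin.≟ x
... | yes _  = zero
... | no r≢x = suc (punchOut r≢x)

unroot : ∀ {n} → Fin (suc n) → Fin (suc n) → Fin (suc n)
unroot r zero    = r
unroot r (suc i) = punchIn r i

unroot-reroot : ∀ {n} (r x : Fin (suc n)) → unroot r (reroot r x) ≡ x
unroot-reroot r x with r Fin.≟ x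
... | yes r≡x = r≡x
... | no r≢x  = Fin.punchIn-punchOut r≢x

reroot-unroot : ∀ {n} (r y : Fin (suc n)) → reroot r (unroot r y) ≡ y
reroot-unroot r zero with r Fin.≟ r
... | yes _  = refl
... | no r≢r = contradiction refl r≢r
reroot-unroot r (suc i) with r Fin.≟ punchIn r i
... | yes r≡p = contradiction (sym r≡p) (Fin.punchInᵢ≢i r i)
... | no r≢p  = cong suc (trans (Fin.punchOut-cong r refl) (Fin.punchOut-punchIn r))

module _ {n} (g : Fin (suc n) → Fin (suc n)) (r : Fin (suc n)) (p : Vec (Fin (suc n)) n)
         (p-g : ∀ i → lookup p i ≡ reroot r (g (punchIn r i))) where

  -- In the new numbering `g` and `parent p` agree except possibly at the root, where a path may
  -- stop anyway.
  reaches⇒isTree : (∀ x → Reaches g r x) → IsTree p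
  reaches⇒isTree reach y = subst (Reaches (parent p) zero) (reroot-unroot r y) (go (reach (unroot r y)))
    where
    back : ∀ y → Reaches (parent p) zero (reroot r (g (unroot r y))) → Reaches (parent p) zero y
    back zero    q = here
    back (suc i) q = step (subst (Reaches (parent p) zero) (sym (p-g i)) q)

    go : ∀ {x} → Reaches g r x → Reaches (parent p) zero (reroot r x)
    go here         = subst (Reaches (parent p) zero) (sym (reroot-unroot r zero)) here
    go (step {x} q) = back (reroot r x)
      (subst (Reaches (parent p) zero ∘ reroot r ∘ g) (sym (unroot-reroot r x)) (go q))

  isTree⇒reaches : IsTree p → ∀ x → Reaches g r x
  isTree⇒reaches t x = subst (Reaches g r) (unroot-reroot r x) (go (t (reroot r x)))
    where
    go : ∀ {y} → Reaches (parent p) zero y → Reaches g r (unroot r y)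
    go here = here
    go {zero}  (step q) = here
    go {suc i} (step q) = step (subst (Reaches g r)
      (trans (cong (unroot r) (p-g i)) (unroot-reroot r _)) (go q))

-- Counting eventually constant maps by their fixed point

constantPower? : ∀ {n} (g : Fin n → Fin n) → Dec (SomePowerConstant g)
constantPower? g = somePowerConstant? g (↔-id _)

-- An eventually constant map has exactly one fixed point, so counting it once per fixed point
-- counts it once.
𝟙-by-fixed-point : ∀ {n} (g : Fin (suc n) → Fin (suc n)) (P? : Dec (SomePowerConstant g)) →
  𝟙 P? ≡ ∑[ r ← allFin (suc n) ] (𝟙 (g r Fin.≟ r) * 𝟙 P?)
𝟙-by-fixed-point {n} g (no _) =
  sym (trans (∑-cong (allFin (suc n)) (λ r → *-zeroʳ (𝟙 (g r Fin.≟ r)))) (∑-zero (allFin (suc n))))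
𝟙-by-fixed-point {n} g (yes s) with r₀ , fix₀ ← fixed-exists g s zero = begin
  1
    ≡⟨ ∑-𝟙-≟ r₀ (λ _ → 1) ⟨
  ∑[ r ← allFin (suc n) ] (𝟙 (r₀ Fin.≟ r) * 1)
    ≡⟨ ∑-cong (allFin (suc n)) (λ r → cong (_* 1)
         (𝟙-cong (r₀ Fin.≟ r) (g r Fin.≟ r) (λ { refl → fix₀ }) (fixed-unique g s fix₀))) ⟩
  ∑[ r ← allFin (suc n) ] (𝟙 (g r Fin.≟ r) * 1) ∎

-- Used with `P` the fixed-point equation at `r`, under which eventual constancy and being a tree
-- are equivalent.
𝟙-*-cong : ∀ {P : Set a} {Q : Set b} {R : Set c} (P? : Dec P) (Q? : Dec Q) (R? : Dec R) →
  (P → Q → R) → (P → R → Q) → 𝟙 P? * 𝟙 Q? ≡ 𝟙 P? * 𝟙 R?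
𝟙-*-cong (yes p) Q? R? to from = cong (_+ 0) (𝟙-cong Q? R? (to p) (from p))
𝟙-*-cong (no _)  Q? R? to from = refl

-- For each candidate fixed point `r`, the value `f r` lies in the fibre over `r` and the other
-- entries form a tree rooted at `r`, so the weighted Cayley formula yields the square of that
-- fibre. The factor `length ys` is inherited from `trees-count`.
eventuallyConstant-count : ∀ n (ys : List B) (h : B → Fin (suc n)) →
  (∑[ f ← vectors ys (suc n) ] 𝟙 (constantPower? (h ∘ lookup f))) * length ys
  ≡ (∑[ u ← ys ] (∑[ v ← ys ] 𝟙 (h u Fin.≟ h v))) * length ys ℕ.^ n
eventuallyConstant-count n ys h = begin
  (∑[ f ← vectors ys (suc n) ] 𝟙 (constantPower? (h ∘ lookup f))) * m
    ≡⟨ cong (_* m) (∑-cong (vectors ys (suc n)) (λ f →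
         𝟙-by-fixed-point (h ∘ lookup f) (constantPower? (h ∘ lookup f)))) ⟩
  (∑[ f ← vectors ys (suc n) ] (∑[ r ← allFin (suc n) ] term f r)) * m
    ≡⟨ cong (_* m) (∑-comm (vectors ys (suc n)) (allFin (suc n)) term) ⟩
  (∑[ r ← allFin (suc n) ] (∑[ f ← vectors ys (suc n) ] term f r)) * m
    ≡⟨ *-distribʳ-∑ (allFin (suc n)) (λ r → ∑[ f ← vectors ys (suc n) ] term f r) m ⟩
  ∑[ r ← allFin (suc n) ] ((∑[ f ← vectors ys (suc n) ] term f r) * m)
    ≡⟨ ∑-cong (allFin (suc n)) rooted ⟩
  ∑[ r ← allFin (suc n) ] (fiber ys h r * fiber ys h r * m ℕ.^ n)
    ≡⟨ *-distribʳ-∑ (allFin (suc n)) (λ r → fiber ys h r * fiber ys h r) (m ℕ.^ n) ⟨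
  (∑[ r ← allFin (suc n) ] (fiber ys h r * fiber ys h r)) * m ℕ.^ n
    ≡⟨ cong (_* m ℕ.^ n) squares ⟩
  (∑[ u ← ys ] (∑[ v ← ys ] 𝟙 (h u Fin.≟ h v))) * m ℕ.^ n ∎
  where
  m = length ys

  term : Vec _ (suc n) → Fin (suc n) → ℕ
  term f r = 𝟙 (h (lookup f r) Fin.≟ r) * 𝟙 (constantPower? (h ∘ lookup f))

  -- Inserting `b` at position `r` decouples the condition at the root from the condition on the
  -- other points.
  cut : ∀ r b f → term (insertAt f r b) r ≡ 𝟙 (h b Fin.≟ r) * 𝟙 (tree? (Vec.map (reroot r ∘ h) f))
  cut r b f = trans
    (cong (λ x → 𝟙 (h x Fin.≟ r) * 𝟙 (constantPower? g)) (Vec.insertAt-lookup f r b))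
    (𝟙-*-cong (h b Fin.≟ r) (constantPower? g) (tree? p)
      (λ fix s → reaches⇒isTree g r p p-g (somePowerConstant⇒reaches g (g-fix fix) s))
      (λ fix t → reaches⇒somePowerConstant g (g-fix fix) (isTree⇒reaches g r p p-g t)))
    where
    g = h ∘ lookup (insertAt f r b)
    p = Vec.map (reroot r ∘ h) f
    g-fix : h b ≡ r → g r ≡ r
    g-fix fix = trans (cong h (Vec.insertAt-lookup f r b)) fix
    p-g : ∀ i → lookup p i ≡ reroot r (g (punchIn r i))
    p-g i = trans (Vec.lookup-map i (reroot r ∘ h) f)
      (cong (reroot r ∘ h) (sym (Vec.insertAt-punchIn f r b i)))

  fiber-reroot : ∀ r → fiber ys (reroot r ∘ h) zero ≡ fiber ys h r
  fiber-reroot r = ∑-cong ys λ y → 𝟙-cong (reroot r (h y) Fin.≟ zero) (h y Fin.≟ r)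
    (λ eq → trans (sym (unroot-reroot r (h y))) (cong (unroot r) eq))
    (λ eq → trans (cong (reroot r) eq) (reroot-unroot r zero))

  rooted : ∀ r → (∑[ f ← vectors ys (suc n) ] term f r) * m ≡ fiber ys h r * fiber ys h r * m ℕ.^ n
  rooted r = begin
    (∑[ f ← vectors ys (suc n) ] term f r) * m
      ≡⟨ cong (_* m) (∑-vectors-insertAt ys r (λ f → term f r)) ⟩
    (∑[ b ← ys ] (∑[ f ← vectors ys n ] term (insertAt f r b) r)) * m
      ≡⟨ cong (_* m) (∑-cong ys (λ b → trans (∑-cong (vectors ys n) (cut r b))
           (sym (*-distribˡ-∑ (vectors ys n) _ (𝟙 (h b Fin.≟ r)))))) ⟩
    (∑[ b ← ys ] (𝟙 (h b Fin.≟ r) * trees ys (reroot r ∘ h))) * m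
      ≡⟨ cong (_* m) (*-distribʳ-∑ ys _ (trees ys (reroot r ∘ h))) ⟨
    fiber ys h r * trees ys (reroot r ∘ h) * m
      ≡⟨ *-assoc (fiber ys h r) _ m ⟩
    fiber ys h r * (trees ys (reroot r ∘ h) * m)
      ≡⟨ cong (fiber ys h r *_) (trees-count n ys (reroot r ∘ h)) ⟩
    fiber ys h r * (fiber ys (reroot r ∘ h) zero * m ℕ.^ n)
      ≡⟨ cong (λ c → fiber ys h r * (c * m ℕ.^ n)) (fiber-reroot r) ⟩
    fiber ys h r * (fiber ys h r * m ℕ.^ n)
      ≡⟨ *-assoc (fiber ys h r) _ _ ⟨
    fiber ys h r * fiber ys h r * m ℕ.^ n ∎

  -- The square of the fibre over `r` counts the pairs whose common image is `r`.
  squares : ∑[ r ← allFin (suc n) ] (fiber ys h r * fiber ys h r) ≡ ∑[ u ← ys ] (∑[ v ← ys ] 𝟙 (h u Fin.≟ h v))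
  squares = begin
    ∑[ r ← allFin (suc n) ] (fiber ys h r * fiber ys h r)
      ≡⟨ ∑-cong (allFin (suc n)) (λ r → *-distribʳ-∑ ys _ (fiber ys h r)) ⟩
    ∑[ r ← allFin (suc n) ] (∑[ v ← ys ] (𝟙 (h v Fin.≟ r) * fiber ys h r))
      ≡⟨ ∑-comm (allFin (suc n)) ys _ ⟩
    ∑[ v ← ys ] (∑[ r ← allFin (suc n) ] (𝟙 (h v Fin.≟ r) * fiber ys h r))
      ≡⟨ ∑-cong ys (λ v → ∑-𝟙-≟ (h v) (fiber ys h)) ⟩
    ∑[ v ← ys ] (∑[ u ← ys ] 𝟙 (h u Fin.≟ h v))
      ≡⟨ ∑-comm ys ys _ ⟩
    ∑[ u ← ys ] (∑[ v ← ys ] 𝟙 (h u Fin.≟ h v)) ∎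

-- Coalescence of two points

-- The entry at `i` is uniform and the others are free; the factor `length xs` on the left avoids
-- the exponent `n - 1`.
∑-lookup : ∀ (xs : List A) {n} (i : Fin n) (f : A → ℕ) →
  (∑[ v ← vectors xs n ] f (lookup v i)) * length xs ≡ length xs ℕ.^ n * ∑ xs f
∑-lookup xs {suc n} i f = begin
  (∑[ v ← vectors xs (suc n) ] f (lookup v i)) * m
    ≡⟨ cong (_* m) (∑-vectors-insertAt xs i (λ v → f (lookup v i))) ⟩
  (∑[ x ← xs ] (∑[ v ← vectors xs n ] f (lookup (insertAt v i x) i))) * m
    ≡⟨ cong (_* m) (∑-cong xs (λ x → ∑-cong (vectors xs n) (λ v → cong f (Vec.insertAt-lookup v i x)))) ⟩
  (∑[ x ← xs ] (∑[ v ← vectors xs n ] f x)) * m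
    ≡⟨ cong (_* m) (∑-cong xs (λ x → trans (∑-const (vectors xs n) (f x))
         (cong (_* f x) (length-vectors xs n)))) ⟩
  (∑[ x ← xs ] (m ℕ.^ n * f x)) * m
    ≡⟨ cong (_* m) (*-distribˡ-∑ xs f (m ℕ.^ n)) ⟨
  m ℕ.^ n * ∑ xs f * m
    ≡⟨ arrange (m ℕ.^ n) (∑ xs f) m ⟩
  m * m ℕ.^ n * ∑ xs f ∎
  where
  m = length xs
  arrange : ∀ s t u → s * t * u ≡ u * s * t
  arrange = solve-∀

-- Two different entries are independent and uniform: once entry `i` is taken out, entry `j` sits at
-- `punchOut i≢j` of the rest.
∑-lookup₂ : ∀ (xs : List A) {n} {i j : Fin (suc n)} → i ≢ j → (f : A → A → ℕ) →
  (∑[ v ← vectors xs (suc n) ] f (lookup v i) (lookup v j)) * length xs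
  ≡ length xs ℕ.^ n * (∑[ x ← xs ] (∑[ y ← xs ] f x y))
∑-lookup₂ xs {n} {i} {j} i≢j f = begin
  (∑[ v ← vectors xs (suc n) ] f (lookup v i) (lookup v j)) * m
    ≡⟨ cong (_* m) (∑-vectors-insertAt xs i (λ v → f (lookup v i) (lookup v j))) ⟩
  (∑[ x ← xs ] (∑[ v ← vectors xs n ] f (lookup (insertAt v i x) i) (lookup (insertAt v i x) j))) * m
    ≡⟨ cong (_* m) (∑-cong xs (λ x → ∑-cong (vectors xs n) (λ v →
         cong₂ f (Vec.insertAt-lookup v i x) (at-j v x)))) ⟩
  (∑[ x ← xs ] (∑[ v ← vectors xs n ] f x (lookup v j′))) * m
    ≡⟨ *-distribʳ-∑ xs _ m ⟩
  ∑[ x ← xs ] ((∑[ v ← vectors xs n ] f x (lookup v j′)) * m)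
    ≡⟨ ∑-cong xs (λ x → ∑-lookup xs j′ (f x)) ⟩
  ∑[ x ← xs ] (m ℕ.^ n * (∑[ y ← xs ] f x y))
    ≡⟨ *-distribˡ-∑ xs _ (m ℕ.^ n) ⟨
  m ℕ.^ n * (∑[ x ← xs ] (∑[ y ← xs ] f x y)) ∎
  where
  m  = length xs
  j′ = punchOut i≢j
  at-j : ∀ v x → lookup (insertAt v i x) j ≡ lookup v j′
  at-j v x = trans (cong (lookup (insertAt v i x)) (sym (Fin.punchIn-punchOut i≢j)))
    (Vec.insertAt-punchIn v i x j′)

-- The head acts first, so that a composite is the map `compose ts` after the random map `lookup t`,
-- the shape counted by `eventuallyConstant-count`.
compose : ∀ {k n} → Vec (Vec (Fin n) n) k → Fin n → Fin n
compose []       = id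
compose (t ∷ ts) = compose ts ∘ lookup t

module _ (n : ℕ) where

  private
    N = suc n
    points = allFin N
    tables = vectors points N

    |points| : length points ≡ N
    |points| = List.length-tabulate id

    |tables| : length tables ≡ N ℕ.^ N
    |tables| = trans (length-vectors points N) (cong (ℕ._^ N) |points|)

  separating : ℕ → Fin N → Fin N → ℕ
  separating k u v = ∑[ ts ← vectors tables k ] 𝟙 (¬? (compose ts u Fin.≟ compose ts v))

  separating-refl : ∀ k u → separating k u u ≡ 0
  separating-refl k u = trans
    (∑-cong (vectors tables k) (λ ts → 𝟙-false (¬? (compose ts u Fin.≟ compose ts u)) (λ ¬refl → ¬refl refl)))
    (∑-zero (vectors tables k))

  -- The diagonal contributes nothing, and there are `N * n` ordered pairs of distinct points
  -- because `n` is `N - 1`.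
  ∑-separating : ∀ k K → (∀ {u v} → u ≢ v → separating k u v * N ℕ.^ k ≡ K) →
    (∑[ u ← points ] (∑[ v ← points ] separating k u v)) * N ℕ.^ k ≡ N * (n * K)
  ∑-separating k K const = begin
    (∑[ u ← points ] (∑[ v ← points ] separating k u v)) * N ℕ.^ k
      ≡⟨ *-distribʳ-∑ points (λ u → ∑ points (separating k u)) (N ℕ.^ k) ⟩
    ∑[ u ← points ] ((∑[ v ← points ] separating k u v) * N ℕ.^ k)
      ≡⟨ ∑-cong points row ⟩
    ∑[ _ ← points ] (n * K)
      ≡⟨ ∑-const points (n * K) ⟩
    length points * (n * K)
      ≡⟨ cong (_* (n * K)) |points| ⟩
    N * (n * K) ∎
    where
    row : ∀ u → (∑[ v ← points ] separating k u v) * N ℕ.^ k ≡ n * K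
    row u = begin
      (∑[ v ← points ] separating k u v) * N ℕ.^ k
        ≡⟨ cong (_* N ℕ.^ k) (∑-allFin-punchIn u (separating k u)) ⟩
      (separating k u u + ∑[ v ← allFin n ] separating k u (punchIn u v)) * N ℕ.^ k
        ≡⟨ cong (λ s → (s + ∑[ v ← allFin n ] separating k u (punchIn u v)) * N ℕ.^ k) (separating-refl k u) ⟩
      (∑[ v ← allFin n ] separating k u (punchIn u v)) * N ℕ.^ k
        ≡⟨ *-distribʳ-∑ (allFin n) (separating k u ∘ punchIn u) (N ℕ.^ k) ⟩
      ∑[ v ← allFin n ] (separating k u (punchIn u v) * N ℕ.^ k)
        ≡⟨ ∑-cong (allFin n) (λ v → const (Fin.punchInᵢ≢i u v ∘ sym)) ⟩
      ∑[ _ ← allFin n ] K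
        ≡⟨ ∑-const (allFin n) K ⟩
      length (allFin n) * K
        ≡⟨ cong (_* K) (List.length-tabulate {n = n} id) ⟩
      n * K ∎

  -- The first table sends `u` and `v` to independent uniform points. Only distinct images count, a
  -- fraction `n / N` of all pairs, and induction handles the later tables.
  separating-count : ∀ k {u v} → u ≢ v → separating k u v * N ℕ.^ k ≡ n ℕ.^ k * (N ℕ.^ N) ℕ.^ k
  separating-count zero    {u} {v} u≢v = cong (λ s → (s + 0) * 1) (𝟙-true (¬? (u Fin.≟ v)) u≢v)
  separating-count (suc k) {u} {v} u≢v = begin
    separating (suc k) u v * (N * N ℕ.^ k)
      ≡⟨ cong (_* (N * N ℕ.^ k)) (∑-vectors-suc tables k _) ⟩
    S * (N * N ℕ.^ k)
      ≡⟨ *-assoc S N (N ℕ.^ k) ⟨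
    S * N * N ℕ.^ k
      ≡⟨ cong (λ z → S * z * N ℕ.^ k) |points| ⟨
    S * length points * N ℕ.^ k
      ≡⟨ cong (_* N ℕ.^ k) (∑-lookup₂ points u≢v (separating k)) ⟩
    length points ℕ.^ n * T * N ℕ.^ k
      ≡⟨ cong (λ z → z ℕ.^ n * T * N ℕ.^ k) |points| ⟩
    N ℕ.^ n * T * N ℕ.^ k
      ≡⟨ *-assoc (N ℕ.^ n) T (N ℕ.^ k) ⟩
    N ℕ.^ n * (T * N ℕ.^ k)
      ≡⟨ cong (N ℕ.^ n *_) (∑-separating k _ (separating-count k)) ⟩
    N ℕ.^ n * (N * (n * (n ℕ.^ k * (N ℕ.^ N) ℕ.^ k)))
      ≡⟨ arrange (N ℕ.^ n) N n (n ℕ.^ k) ((N ℕ.^ N) ℕ.^ k) ⟩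
    n * n ℕ.^ k * (N * N ℕ.^ n * (N ℕ.^ N) ℕ.^ k) ∎
    where
    S = ∑[ t ← tables ] separating k (lookup t u) (lookup t v)
    T = ∑[ x ← points ] (∑[ y ← points ] separating k x y)
    arrange : ∀ a b c d e → a * (b * (c * (d * e))) ≡ c * d * (b * a * e)
    arrange = solve-∀

  -- The proportion of favourable tuples is 1 minus the power `suc k` of `n / N`; here denominators
  -- are cleared and the subtraction is moved across. One factor `n / N` is the chance that two
  -- random points differ, the other `k` that the tables after the first keep them apart.
  tuples-count-suc : ∀ k →
    (∑[ ts ← vectors tables (suc k) ] 𝟙 (constantPower? (compose ts))) * N ℕ.^ suc k
      + n ℕ.^ suc k * (N ℕ.^ N) ℕ.^ suc k
    ≡ N ℕ.^ suc k * (N ℕ.^ N) ℕ.^ suc k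
  tuples-count-suc k = begin
    E * (N * N ℕ.^ k) + n * n ℕ.^ k * (N * N ℕ.^ n * (N ℕ.^ N) ℕ.^ k)
      ≡⟨ arrange₁ E N (N ℕ.^ k) n (n ℕ.^ k) (N ℕ.^ n) ((N ℕ.^ N) ℕ.^ k) ⟩
    E * N * N ℕ.^ k + N * (n * (n ℕ.^ k * (N ℕ.^ N) ℕ.^ k)) * N ℕ.^ n
      ≡⟨ cong₂ (λ x y → x * N ℕ.^ k + y * N ℕ.^ n) E-count (sym (∑-separating k _ (separating-count k))) ⟩
    Q * N ℕ.^ n * N ℕ.^ k + T * N ℕ.^ k * N ℕ.^ n
      ≡⟨ arrange₂ Q T (N ℕ.^ n) (N ℕ.^ k) ⟩
    (Q + T) * (N ℕ.^ n * N ℕ.^ k)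
      ≡⟨ cong (_* (N ℕ.^ n * N ℕ.^ k)) Q+T ⟩
    N * (N * (N ℕ.^ N) ℕ.^ k) * (N ℕ.^ n * N ℕ.^ k)
      ≡⟨ arrange₃ N ((N ℕ.^ N) ℕ.^ k) (N ℕ.^ n) (N ℕ.^ k) ⟩
    N * N ℕ.^ k * (N * N ℕ.^ n * (N ℕ.^ N) ℕ.^ k) ∎
    where
    E = ∑[ ts ← vectors tables (suc k) ] 𝟙 (constantPower? (compose ts))
    equal : Vec (Vec (Fin N) N) k → Fin N → Fin N → ℕ
    equal ts u v = 𝟙 (compose ts u Fin.≟ compose ts v)
    merging : Fin N → Fin N → ℕ
    merging u v = ∑[ ts ← vectors tables k ] equal ts u v
    Q = ∑[ u ← points ] (∑[ v ← points ] merging u v)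
    T = ∑[ u ← points ] (∑[ v ← points ] separating k u v)

    arrange₁ : ∀ E N a n b c d → E * (N * a) + n * b * (N * c * d) ≡ E * N * a + N * (n * (b * d)) * c
    arrange₁ = solve-∀
    arrange₂ : ∀ Q T a b → Q * a * b + T * b * a ≡ (Q + T) * (a * b)
    arrange₂ = solve-∀
    arrange₃ : ∀ N a b c → N * (N * a) * (b * c) ≡ N * c * (N * b * a)
    arrange₃ = solve-∀

    -- With the later tables held fixed, the first one is the random map and the composite of the
    -- others is `h`.
    E-count : E * N ≡ Q * N ℕ.^ n
    E-count = begin
      E * N
        ≡⟨ cong (_* N) (trans (∑-vectors-suc tables k _) (∑-comm tables (vectors tables k) _)) ⟩
      (∑[ ts ← vectors tables k ] (∑[ t ← tables ] 𝟙 (constantPower? (compose ts ∘ lookup t)))) * N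
        ≡⟨ *-distribʳ-∑ (vectors tables k) _ N ⟩
      ∑[ ts ← vectors tables k ] ((∑[ t ← tables ] 𝟙 (constantPower? (compose ts ∘ lookup t))) * N)
        ≡⟨ ∑-cong (vectors tables k) (λ ts →
             subst (λ m → (∑[ t ← tables ] 𝟙 (constantPower? (compose ts ∘ lookup t))) * m
                        ≡ (∑[ u ← points ] (∑[ v ← points ] equal ts u v)) * m ℕ.^ n)
               |points| (eventuallyConstant-count n points (compose ts))) ⟩
      ∑[ ts ← vectors tables k ] ((∑[ u ← points ] (∑[ v ← points ] equal ts u v)) * N ℕ.^ n)
        ≡⟨ *-distribʳ-∑ (vectors tables k) _ (N ℕ.^ n) ⟨
      (∑[ ts ← vectors tables k ] (∑[ u ← points ] (∑[ v ← points ] equal ts u v))) * N ℕ.^ n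
        ≡⟨ cong (_* N ℕ.^ n) (trans (∑-comm (vectors tables k) points _)
             (∑-cong points (λ u → ∑-comm (vectors tables k) points _))) ⟩
      Q * N ℕ.^ n ∎

    pair : ∀ u v → merging u v + separating k u v ≡ (N ℕ.^ N) ℕ.^ k
    pair u v = begin
      merging u v + separating k u v
        ≡⟨ ∑-distrib-+ (vectors tables k) _ _ ⟨
      ∑[ ts ← vectors tables k ] (equal ts u v + 𝟙 (¬? (compose ts u Fin.≟ compose ts v)))
        ≡⟨ ∑-cong (vectors tables k) (λ ts → 𝟙-¬ (compose ts u Fin.≟ compose ts v)) ⟩
      ∑[ _ ← vectors tables k ] 1
        ≡⟨ trans (∑-const (vectors tables k) 1) (*-identityʳ _) ⟩
      length (vectors tables k)
        ≡⟨ trans (length-vectors tables k) (cong (ℕ._^ k) |tables|) ⟩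
      (N ℕ.^ N) ℕ.^ k ∎

    Q+T : Q + T ≡ N * (N * (N ℕ.^ N) ℕ.^ k)
    Q+T = begin
      Q + T
        ≡⟨ ∑-distrib-+ points (λ u → ∑ points (merging u)) (λ u → ∑ points (separating k u)) ⟨
      ∑[ u ← points ] ((∑[ v ← points ] merging u v) + (∑[ v ← points ] separating k u v))
        ≡⟨ ∑-cong points (λ u →
             trans (sym (∑-distrib-+ points (merging u) (separating k u))) (∑-cong points (pair u))) ⟩
      ∑[ _ ← points ] (∑[ _ ← points ] ((N ℕ.^ N) ℕ.^ k))
        ≡⟨ trans (∑-const points _) (cong₂ _*_ |points|
             (trans (∑-const points _) (cong (_* (N ℕ.^ N) ℕ.^ k) |points|))) ⟩
      N * (N * (N ℕ.^ N) ℕ.^ k) ∎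

tuples-count : ∀ n .{{_ : NonZero n}} k →
    (∑[ ts ← vectors (vectors (allFin n) n) (suc k) ] 𝟙 (constantPower? (compose ts))) * n ℕ.^ suc k
      + ℕ.pred n ℕ.^ suc k * (n ℕ.^ n) ℕ.^ suc k
    ≡ n ℕ.^ suc k * (n ℕ.^ n) ℕ.^ suc k
tuples-count (suc n) k = tuples-count-suc n k

-- Tuples as tables of values

∑-allFin-+ : ∀ m n (f : Fin (m + n) → ℕ) →
  ∑ (allFin (m + n)) f ≡ ∑[ i ← allFin m ] f (i ↑ˡ n) + ∑[ j ← allFin n ] f (m ↑ʳ j)
∑-allFin-+ zero    n f = refl
∑-allFin-+ (suc m) n f = begin
  ∑ (allFin (suc m + n)) f
    ≡⟨ ∑-allFin-suc f ⟩
  f zero + ∑ (allFin (m + n)) (f ∘ suc)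
    ≡⟨ cong (f zero +_) (∑-allFin-+ m n (f ∘ suc)) ⟩
  f zero + (∑[ i ← allFin m ] f (suc (i ↑ˡ n)) + rest)
    ≡⟨ +-assoc (f zero) _ rest ⟨
  f zero + ∑[ i ← allFin m ] f (suc (i ↑ˡ n)) + rest
    ≡⟨ cong (_+ rest) (∑-allFin-suc (λ i → f (i ↑ˡ n))) ⟨
  ∑[ i ← allFin (suc m) ] f (i ↑ˡ n) + rest ∎
  where rest = ∑[ j ← allFin n ] f (suc m ↑ʳ j)

∑-allFin-combine : ∀ m n (f : Fin (m * n) → ℕ) →
  ∑ (allFin (m * n)) f ≡ ∑[ i ← allFin m ] (∑[ j ← allFin n ] f (combine i j))
∑-allFin-combine zero    n f = refl
∑-allFin-combine (suc m) n f = begin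
  ∑ (allFin (n + m * n)) f
    ≡⟨ ∑-allFin-+ n (m * n) f ⟩
  row₀ + ∑[ j ← allFin (m * n) ] f (n ↑ʳ j)
    ≡⟨ cong (row₀ +_) (∑-allFin-combine m n (λ j → f (n ↑ʳ j))) ⟩
  row₀ + ∑[ i ← allFin m ] (∑[ j ← allFin n ] f (n ↑ʳ combine i j))
    ≡⟨ ∑-allFin-suc (λ i → ∑[ j ← allFin n ] f (combine {suc m} i j)) ⟨
  ∑[ i ← allFin (suc m) ] (∑[ j ← allFin n ] f (combine i j)) ∎
  where row₀ = ∑[ j ← allFin n ] f (j ↑ˡ (m * n))

-- A code is the word of its base-`n` digits; `combine x d` has leading digit `x`, followed by the
-- digits of `d`.
∑-finToFun : ∀ m n (f : Vec (Fin n) m → ℕ) →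
  ∑[ c ← allFin (n ℕ.^ m) ] f (tabulate (finToFun c)) ≡ ∑ (vectors (allFin n) m) f
∑-finToFun zero    n f = refl
∑-finToFun (suc m) n f = begin
  ∑[ c ← allFin (n * n ℕ.^ m) ] f (tabulate (finToFun c))
    ≡⟨ ∑-allFin-combine n (n ℕ.^ m) _ ⟩
  ∑[ x ← allFin n ] (∑[ d ← allFin (n ℕ.^ m) ] f (tabulate (finToFun (combine x d))))
    ≡⟨ ∑-cong (allFin n) (λ x → ∑-cong (allFin (n ℕ.^ m)) (λ d → cong f (digits x d))) ⟩
  ∑[ x ← allFin n ] (∑[ d ← allFin (n ℕ.^ m) ] f (x ∷ tabulate (finToFun d)))
    ≡⟨ ∑-cong (allFin n) (λ x → ∑-finToFun m n (λ v → f (x ∷ v))) ⟩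
  ∑[ x ← allFin n ] (∑[ v ← vectors (allFin n) m ] f (x ∷ v))
    ≡⟨ ∑-vectors-suc (allFin n) m f ⟨
  ∑ (vectors (allFin n) (suc m)) f ∎
  where
  digits : ∀ x d → tabulate {n = suc m} (finToFun (combine x d)) ≡ x ∷ tabulate (finToFun {n} {m} d)
  digits x d = cong (λ (q , r) → q ∷ tabulate (finToFun r)) (Fin.remQuot-combine x d)

-- The cut follows `combine` because that is how `decode` addresses the entry of a table.
rows : ∀ k n → Vec A (k * n) → Vec (Vec A n) k
rows k n v = tabulate λ i → tabulate λ j → lookup v (combine i j)

lookup-rows : ∀ {k n} (v : Vec A (k * n)) (i : Fin k) (j : Fin n) →
              lookup (lookup (rows k n v) i) j ≡ lookup v (combine i j)
lookup-rows v i j = trans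
  (cong (λ r → lookup r j) (Vec.lookup∘tabulate (λ i → tabulate (λ j → lookup v (combine i j))) i))
  (Vec.lookup∘tabulate (λ j → lookup v (combine i j)) j)

rows-concat : ∀ {k n} (vs : Vec (Vec A n) k) → rows k n (Vec.concat vs) ≡ vs
rows-concat vs = trans
  (Vec.tabulate-cong λ i → trans (Vec.tabulate-cong λ j → Vec.lookup-concat vs i j)
    (Vec.tabulate∘lookup (lookup vs i)))
  (Vec.tabulate∘lookup vs)

-- `fold′` puts the last arc outermost, whereas `compose` consumes the first table; this detaches
-- the first arc.
fold′-shift : ∀ {k} (X : Fin (suc (suc k)) → Set ℓ) (f : ∀ i → X (inject₁ i) → X (suc i)) x (i : Fin (suc k)) →
              fold′ X f x (suc i) ≡ fold′ (X ∘ suc) (f ∘ suc) (f zero x) i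
fold′-shift             X f x zero    = refl
fold′-shift {k = suc k} X f x (suc i) = cong (f (suc i)) (fold′-shift (X ∘ inject₁) (f ∘ inject₁) x i)

-- The induction passes to `X ∘ suc`, which loses the set `X zero` where the tuple closes up. Hence
-- the closing map is kept apart as `last`, with values in `Fin n`.
fold′-compose : ∀ {k n} (X : Fin (suc k) → Set ℓ) (f : ∀ i → X (inject₁ i) → X (suc i))
  (last : X (fromℕ k) → Fin n) (π : ∀ i → X i → Fin n) (ts : Vec (Vec (Fin n) n) (suc k)) →
  (∀ i x → π (suc i) (f i x) ≡ lookup (lookup ts (inject₁ i)) (π (inject₁ i) x)) →
  (∀ x → last x ≡ lookup (lookup ts (fromℕ k)) (π (fromℕ k) x)) →
  ∀ x → last (fold′ X f x (fromℕ k)) ≡ compose ts (π zero x)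
fold′-compose {k = zero}  X f last π (t ∷ []) arcs lasts x = lasts x
fold′-compose {k = suc k} X f last π (t ∷ ts) arcs lasts x = begin
  last (fold′ X f x (suc (fromℕ k)))
    ≡⟨ cong last (fold′-shift X f x (fromℕ k)) ⟩
  last (fold′ (X ∘ suc) (f ∘ suc) (f zero x) (fromℕ k))
    ≡⟨ fold′-compose (X ∘ suc) (f ∘ suc) last (π ∘ suc) ts (arcs ∘ suc) lasts (f zero x) ⟩
  compose ts (π (suc zero) (f zero x))
    ≡⟨ cong (compose ts) (arcs zero x) ⟩
  compose ts (lookup t (π zero x)) ∎

-- Eventual constancy under conjugation

module _ {A : Set a} {B : Set b} (e : B ↔ A) (g : A → A) (g′ : B → B) where

  open Inverse e using (to; from; strictlyInverseˡ; strictlyInverseʳ)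
  open Endo A using () renaming (_^_ to _^ᴬ_)
  open Endo B using () renaming (_^_ to _^ᴮ_)

  module _ (conjugate : ∀ x → from (g x) ≡ g′ (from x)) where

    ^-conjugate : ∀ m x → from ((g ^ᴬ m) x) ≡ (g′ ^ᴮ m) (from x)
    ^-conjugate zero    x = refl
    ^-conjugate (suc m) x = trans (conjugate _) (cong g′ (^-conjugate m x))

    somePowerConstant-from : SomePowerConstant g → SomePowerConstant g′
    somePowerConstant-from (m , 1≤m , const) = m , 1≤m , λ x y → begin
      (g′ ^ᴮ m) x              ≡⟨ cong (g′ ^ᴮ m) (strictlyInverseʳ x) ⟨
      (g′ ^ᴮ m) (from (to x))  ≡⟨ ^-conjugate m (to x) ⟨
      from ((g ^ᴬ m) (to x))   ≡⟨ cong from (const (to x) (to y)) ⟩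
      from ((g ^ᴬ m) (to y))   ≡⟨ ^-conjugate m (to y) ⟩
      (g′ ^ᴮ m) (from (to y))  ≡⟨ cong (g′ ^ᴮ m) (strictlyInverseʳ y) ⟩
      (g′ ^ᴮ m) y              ∎

    somePowerConstant-to : SomePowerConstant g′ → SomePowerConstant g
    somePowerConstant-to (m , 1≤m , const) = m , 1≤m , λ x y → begin
      (g ^ᴬ m) x              ≡⟨ strictlyInverseˡ _ ⟨
      to (from ((g ^ᴬ m) x))  ≡⟨ cong to (^-conjugate m x) ⟩
      to ((g′ ^ᴮ m) (from x)) ≡⟨ cong to (const (from x) (from y)) ⟩
      to ((g′ ^ᴮ m) (from y)) ≡⟨ cong to (^-conjugate m y) ⟨
      to (from ((g ^ᴬ m) y))  ≡⟨ strictlyInverseˡ _ ⟩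
      (g ^ᴬ m) y              ∎

-- The number of eventually constant tuples

module _ {k n} {X : Fin (suc k) → Set ℓ} (e : ∀ i → Fin n ↔ X i) where

  private
    module e i = Inverse (e i)

  tablesOf : Fin (n ℕ.^ (suc k * n)) → Vec (Vec (Fin n) n) (suc k)
  tablesOf c = rows (suc k) n (tabulate (finToFun c))

  -- The bijections inserted by `decode` cancel between consecutive functions, so `e.from zero`
  -- conjugates the composite to the composite of the bare tables.
  composite-decode : ∀ c x → e.from zero (composite (decode e c) x) ≡ compose (tablesOf c) (e.from zero x)
  composite-decode c = fold′-compose X (arc (decode e c)) (e.from zero ∘ close (decode e c)) e.from (tablesOf c)
    (λ i x → trans (e.strictlyInverseʳ (suc i) _) (sym (entry (inject₁ i) (e.from (inject₁ i) x))))
    (λ x → trans (e.strictlyInverseʳ zero _) (sym (entry (fromℕ k) (e.from (fromℕ k) x))))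
    where
    entry : ∀ (i : Fin (suc k)) y → lookup (lookup (tablesOf c) i) y ≡ finToFun c (combine i y)
    entry i y = trans (lookup-rows (tabulate (finToFun c)) i y)
      (Vec.lookup∘tabulate (finToFun {n} {suc k * n} c) (combine i y))

  favourable : ℕ
  favourable = length (filter (eventuallyConstant? e) (allTuples e))

  favourable≡ : favourable ≡ ∑[ ts ← vectors (vectors (allFin n) n) (suc k) ] 𝟙 (constantPower? (compose ts))
  favourable≡ = begin
    favourable
      ≡⟨ length-filter (eventuallyConstant? e) (allTuples e) ⟩
    ∑[ t ← allTuples e ] 𝟙 (eventuallyConstant? e t)
      ≡⟨ ∑-map (decode e) (allFin _) _ ⟩
    ∑[ c ← allFin _ ] 𝟙 (eventuallyConstant? e (decode e c))
      -- The two decision procedures are compared only through the equivalence of what they decide.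
      ≡⟨ ∑-cong (allFin _) (λ c → 𝟙-cong
           (eventuallyConstant? e (decode e c)) (constantPower? (compose (tablesOf c)))
           (somePowerConstant-from (e zero) _ _ (composite-decode c))
           (somePowerConstant-to (e zero) _ _ (composite-decode c))) ⟩
    ∑[ c ← allFin (n ℕ.^ (suc k * n)) ] indicator (tabulate (finToFun c))
      ≡⟨ ∑-finToFun (suc k * n) n indicator ⟩
    ∑ (vectors (allFin n) (suc k * n)) indicator
      ≡⟨ ∑-vectors-concat (allFin n) n (suc k) indicator ⟩
    ∑[ ts ← vectors (vectors (allFin n) n) (suc k) ] indicator (Vec.concat ts)
      ≡⟨ ∑-cong (vectors (vectors (allFin n) n) (suc k)) (λ ts →
           cong (λ r → 𝟙 (constantPower? (compose r))) (rows-concat ts)) ⟩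
    ∑[ ts ← vectors (vectors (allFin n) n) (suc k) ] 𝟙 (constantPower? (compose ts)) ∎
    where
    indicator : Vec (Fin n) (suc k * n) → ℕ
    indicator v = 𝟙 (constantPower? (compose (rows (suc k) n v)))

favourable-count : ∀ {k n} .{{_ : NonZero n}} {X : Fin (suc k) → Set ℓ} (e : ∀ i → Fin n ↔ X i) →
  favourable e * n ℕ.^ suc k + ℕ.pred n ℕ.^ suc k * n ℕ.^ (suc k * n) ≡ n ℕ.^ suc k * n ℕ.^ (suc k * n)
favourable-count {k = k} {n} e =
  subst₂ (λ E D → E * n ℕ.^ suc k + ℕ.pred n ℕ.^ suc k * D ≡ n ℕ.^ suc k * D)
    (sym (favourable≡ e))
    (trans (^-*-assoc n n (suc k)) (cong (n ℕ.^_) (*-comm n (suc k))))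
    (tuples-count n k)

-- Rational arithmetic

-- Opened only here because the prefix +_ clashes with sections of the addition of ℕ.
open import Data.Integer.Base using (+_)

-- Sums in ℚ are normalised, so the equation is checked on unnormalised fractions, up to `≃`.
fromℚᵘ-homo-+ : ∀ p q → ℚ.fromℚᵘ (p ℚᵘ.+ q) ≡ ℚ.fromℚᵘ p ℚ.+ ℚ.fromℚᵘ q
fromℚᵘ-homo-+ p q = ℚ.toℚᵘ-injective (ℚᵘ.≃-trans (ℚ.toℚᵘ-fromℚᵘ (p ℚᵘ.+ q)) (ℚᵘ.≃-sym
  (ℚᵘ.≃-trans (ℚ.toℚᵘ-homo-+ (ℚ.fromℚᵘ p) (ℚ.fromℚᵘ q)) (ℚᵘ.+-cong (ℚ.toℚᵘ-fromℚᵘ p) (ℚ.toℚᵘ-fromℚᵘ q)))))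

fromℚᵘ-homo-* : ∀ p q → ℚ.fromℚᵘ (p ℚᵘ.* q) ≡ ℚ.fromℚᵘ p ℚ.* ℚ.fromℚᵘ q
fromℚᵘ-homo-* p q = ℚ.toℚᵘ-injective (ℚᵘ.≃-trans (ℚ.toℚᵘ-fromℚᵘ (p ℚᵘ.* q)) (ℚᵘ.≃-sym
  (ℚᵘ.≃-trans (ℚ.toℚᵘ-homo-* (ℚ.fromℚᵘ p) (ℚ.fromℚᵘ q)) (ℚᵘ.*-cong (ℚ.toℚᵘ-fromℚᵘ p) (ℚ.toℚᵘ-fromℚᵘ q)))))

fromℕℚ : ℕ → ℚ
fromℕℚ a = + a / 1

fromℕℚ-+ : ∀ a b → fromℕℚ (a + b) ≡ fromℕℚ a ℚ.+ fromℕℚ b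
fromℕℚ-+ a b = trans
  (ℚ.fromℚᵘ-cong {mkℚᵘ (+ (a + b)) 0} {mkℚᵘ (+ a) 0 ℚᵘ.+ mkℚᵘ (+ b) 0} (*≡* (cong (ℤ._* + 1)
    (sym (cong₂ ℤ._+_ (ℤ.*-identityʳ (+ a)) (ℤ.*-identityʳ (+ b)))))))
  (fromℚᵘ-homo-+ (mkℚᵘ (+ a) 0) (mkℚᵘ (+ b) 0))

fromℕℚ-* : ∀ a b → fromℕℚ (a * b) ≡ fromℕℚ a ℚ.* fromℕℚ b
fromℕℚ-* a b = trans
  (cong (λ z → z / 1) (ℤ.pos-* a b))
  (fromℚᵘ-homo-* (mkℚᵘ (+ a) 0) (mkℚᵘ (+ b) 0))

fromℕℚ-^ : ∀ a k → fromℕℚ (a ℕ.^ k) ≡ fromℕℚ a ^ k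
fromℕℚ-^ a zero    = refl
fromℕℚ-^ a (suc k) = trans (fromℕℚ-* a (a ℕ.^ k)) (cong (fromℕℚ a ℚ.*_) (fromℕℚ-^ a k))

/-as-* : ∀ a d .{{_ : NonZero d}} → + a / d ≡ fromℕℚ a ℚ.* (+ 1 / d)
/-as-* a (suc d) = trans
  (ℚ.fromℚᵘ-cong {mkℚᵘ (+ a) d} {mkℚᵘ (+ a) 0 ℚᵘ.* mkℚᵘ (+ 1) d}
    (*≡* (cong₂ ℤ._*_ (sym (ℤ.*-identityʳ (+ a))) (cong +_ (+-identityʳ (suc d))))))
  (fromℚᵘ-homo-* (mkℚᵘ (+ a) 0) (mkℚᵘ (+ 1) d))

*-1/ : ∀ d .{{_ : NonZero d}} → fromℕℚ d ℚ.* (+ 1 / d) ≡ 1ℚ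
*-1/ d@(suc d-1) = trans (sym (/-as-* d d))
  (ℚ.fromℚᵘ-cong {mkℚᵘ (+ d) d-1} {mkℚᵘ (+ 1) 0} (*≡* (ℤ.*-comm (+ d) (+ 1))))

1^ : ∀ k → 1ℚ ^ k ≡ 1ℚ
1^ zero    = refl
1^ (suc k) = trans (ℚ.*-identityˡ _) (1^ k)

-- Here `x` and `y` are the reciprocals of `N` and `D`. Treating them as variables with equations
-- reduces division by `N * D` to ring identities.
solve-ratio : ∀ (E D N n x y : ℚ) {z} → E ℚ.* N ℚ.+ n ℚ.* D ≡ N ℚ.* D →
  N ℚ.* x ≡ 1ℚ → n ℚ.* x ≡ z → D ℚ.* y ≡ 1ℚ → E ℚ.* y ≡ 1ℚ - z
solve-ratio E D N n x y {z} eq Nx≡1 nx≡z Dy≡1 = begin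
  E ℚ.* y
    ≡⟨ ℚ.*-identityʳ (E ℚ.* y) ⟨
  E ℚ.* y ℚ.* 1ℚ
    ≡⟨ cong (E ℚ.* y ℚ.*_) Nx≡1 ⟨
  E ℚ.* y ℚ.* (N ℚ.* x)
    ≡⟨ solve 6 (λ E D N n x y → E :* y :* (N :* x) := (E :* N :+ n :* D :- n :* D) :* (y :* x)) refl E D N n x y ⟩
  (E ℚ.* N ℚ.+ n ℚ.* D - n ℚ.* D) ℚ.* (y ℚ.* x)
    ≡⟨ cong (λ r → (r - n ℚ.* D) ℚ.* (y ℚ.* x)) eq ⟩
  (N ℚ.* D - n ℚ.* D) ℚ.* (y ℚ.* x)
    ≡⟨ solve 5 (λ D N n x y → (N :* D :- n :* D) :* (y :* x) := (N :* x :- n :* x) :* (D :* y)) refl D N n x y ⟩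
  (N ℚ.* x - n ℚ.* x) ℚ.* (D ℚ.* y)
    ≡⟨ cong₂ ℚ._*_ (cong₂ _-_ Nx≡1 nx≡z) Dy≡1 ⟩
  (1ℚ - z) ℚ.* 1ℚ
    ≡⟨ ℚ.*-identityʳ (1ℚ - z) ⟩
  1ℚ - z ∎
  where open +-*-Solver

pred*-1/ : ∀ n .{{_ : NonZero n}} → fromℕℚ (ℕ.pred n) ℚ.* (+ 1 / n) ≡ 1ℚ - + 1 / n
pred*-1/ n@(suc n-1) = begin
  fromℕℚ n-1 ℚ.* x
    ≡⟨ solve 2 (λ a b → a :* b := (con 1ℚ :+ a) :* b :- b) refl (fromℕℚ n-1) x ⟩
  (1ℚ ℚ.+ fromℕℚ n-1) ℚ.* x - x
    ≡⟨ cong (λ z → z ℚ.* x - x) (fromℕℚ-+ 1 n-1) ⟨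
  fromℕℚ n ℚ.* x - x
    ≡⟨ cong (_- x) (*-1/ n) ⟩
  1ℚ - x ∎
  where
  x = + 1 / n
  open +-*-Solver

/≡1-^ : ∀ E n D k .{{_ : NonZero n}} .{{_ : NonZero D}} → E * n ℕ.^ k + ℕ.pred n ℕ.^ k * D ≡ n ℕ.^ k * D →
        + E / D ≡ 1ℚ - (1ℚ - + 1 / n) ^ k
-- The reciprocal of `n ℕ.^ k` is taken to be the `k`-th power of `1 / n`, so that products of
-- powers become powers of products.
/≡1-^ E n D k eq = trans (/-as-* E D) (solve-ratio
  (fromℕℚ E) (fromℕℚ D) (fromℕℚ (n ℕ.^ k)) (fromℕℚ (ℕ.pred n ℕ.^ k)) ((+ 1 / n) ^ k) (+ 1 / D)
  (trans (sym (homo-+-* E (n ℕ.^ k) (ℕ.pred n ℕ.^ k) D)) (trans (cong fromℕℚ eq) (fromℕℚ-* (n ℕ.^ k) D)))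
  (trans (power n) (trans (cong (_^ k) (*-1/ n)) (1^ k)))
  (trans (power (ℕ.pred n)) (cong (_^ k) (pred*-1/ n)))
  (*-1/ D))
  where
  power : ∀ m → fromℕℚ (m ℕ.^ k) ℚ.* (+ 1 / n) ^ k ≡ (fromℕℚ m ℚ.* (+ 1 / n)) ^ k
  power m = trans (cong (ℚ._* (+ 1 / n) ^ k) (fromℕℚ-^ m k))
    (sym (^-distrib-* (fromℕℚ m) (+ 1 / n) k))

  homo-+-* : ∀ a b c d → fromℕℚ (a * b + c * d) ≡ fromℕℚ a ℚ.* fromℕℚ b ℚ.+ fromℕℚ c ℚ.* fromℕℚ d
  homo-+-* a b c d = trans (fromℕℚ-+ (a * b) (c * d)) (cong₂ ℚ._+_ (fromℕℚ-* a b) (fromℕℚ-* c d))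

1/≤1 : ∀ n .{{_ : NonZero n}} → + 1 / n ℚ.≤ 1ℚ
1/≤1 (suc n) = ℚ.toℚᵘ-cancel-≤ (ℚᵘ.≤-respˡ-≃ (ℚᵘ.≃-sym (ℚ.toℚᵘ-fromℚᵘ (mkℚᵘ (+ 1) n)))
  (ℚᵘ.*≤* (ℤ.+≤+ (s≤s z≤n))))

-- The binomial remainder

remainder : ℚ → ℕ → ℚ
remainder x k = (1ℚ - x) ^ k - (1ℚ - fromℕℚ k ℚ.* x)

remainder-suc : ∀ x k → remainder x (suc k) ≡ (1ℚ - x) ℚ.* remainder x k ℚ.+ fromℕℚ k ℚ.* (x ^ 2)
remainder-suc x k = begin
  (1ℚ - x) ℚ.* (1ℚ - x) ^ k - (1ℚ - fromℕℚ (suc k) ℚ.* x)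
    ≡⟨ cong (λ z → (1ℚ - x) ℚ.* (1ℚ - x) ^ k - (1ℚ - z ℚ.* x)) (fromℕℚ-+ 1 k) ⟩
  (1ℚ - x) ℚ.* (1ℚ - x) ^ k - (1ℚ - (1ℚ ℚ.+ fromℕℚ k) ℚ.* x)
    ≡⟨ solve 3 (λ x y k → (con 1ℚ :- x) :* y :- (con 1ℚ :- (con 1ℚ :+ k) :* x)
           := (con 1ℚ :- x) :* (y :- (con 1ℚ :- k :* x)) :+ k :* (x :* (x :* con 1ℚ)))
         refl x ((1ℚ - x) ^ k) (fromℕℚ k) ⟩
  (1ℚ - x) ℚ.* remainder x k ℚ.+ fromℕℚ k ℚ.* (x ^ 2) ∎
  where open +-*-Solver

0≤* : ∀ {p q} → 0ℚ ℚ.≤ p → 0ℚ ℚ.≤ q → 0ℚ ℚ.≤ p ℚ.* q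
0≤* {p} {q} 0≤p 0≤q = ℚ.nonNegative⁻¹ (p ℚ.* q)
  {{ℚ.nonNeg*nonNeg⇒nonNeg p {{ℚ.nonNegative 0≤p}} q {{ℚ.nonNegative 0≤q}}}}

0≤fromℕℚ : ∀ k → 0ℚ ℚ.≤ fromℕℚ k
0≤fromℕℚ k = ℚ.nonNegative⁻¹ (fromℕℚ k) {{ℚ.normalize-nonNeg k 1}}

-- In closed form this is `k (k - 1) / 2`, the coefficient of `x ^ 2` in the expansion of
-- `(1 - x) ^ k`.
remainderBound : ℕ → ℚ
remainderBound zero    = 0ℚ
remainderBound (suc k) = remainderBound k ℚ.+ fromℕℚ k

module _ {x : ℚ} (0≤x : 0ℚ ℚ.≤ x) (x≤1 : x ℚ.≤ 1ℚ) where

  private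
    0≤1-x : 0ℚ ℚ.≤ 1ℚ - x
    0≤1-x = subst (ℚ._≤ 1ℚ - x) (ℚ.+-inverseʳ x) (ℚ.+-monoˡ-≤ (ℚ.- x) x≤1)

    1-x≤1 : 1ℚ - x ℚ.≤ 1ℚ
    1-x≤1 = ℚ.+-monoʳ-≤ 1ℚ (ℚ.neg-antimono-≤ 0≤x)

  0≤x² : 0ℚ ℚ.≤ x ^ 2
  0≤x² = 0≤* 0≤x (0≤* 0≤x (ℚ.*≤* (ℤ.+≤+ z≤n)))

  -- Bernoulli's inequality: for `0 ≤ x ≤ 1` both summands of the recurrence are nonnegative.
  0≤remainder : ∀ k → 0ℚ ℚ.≤ remainder x k
  0≤remainder zero    = ℚ.≤-reflexive (sym (solve 1 (λ x → con 1ℚ :- (con 1ℚ :- con 0ℚ :* x) := con 0ℚ) refl x))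
    where open +-*-Solver
  0≤remainder (suc k) = subst (0ℚ ℚ.≤_) (sym (remainder-suc x k))
    (ℚ.+-mono-≤ (0≤* 0≤1-x (0≤remainder k)) (0≤* (0≤fromℕℚ k) 0≤x²))

  -- Dropping the factor `1 - x` from the recurrence leaves the increment `k * x ^ 2` at each stage;
  -- the remainder being nonnegative, this can only enlarge the right-hand side.
  remainder≤ : ∀ k → remainder x k ℚ.≤ remainderBound k ℚ.* (x ^ 2)
  remainder≤ zero    = ℚ.≤-reflexive
    (solve 1 (λ x → con 1ℚ :- (con 1ℚ :- con 0ℚ :* x) := con 0ℚ :* (x :* (x :* con 1ℚ))) refl x)
    where open +-*-Solver
  remainder≤ (suc k) = subst₂ ℚ._≤_
    (sym (remainder-suc x k))
    (sym (ℚ.*-distribʳ-+ (x ^ 2) (remainderBound k) (fromℕℚ k)))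
    (ℚ.+-monoˡ-≤ (fromℕℚ k ℚ.* (x ^ 2)) (ℚ.≤-trans shrink (remainder≤ k)))
    where
    shrink : (1ℚ - x) ℚ.* remainder x k ℚ.≤ remainder x k
    shrink = subst ((1ℚ - x) ℚ.* remainder x k ℚ.≤_) (ℚ.*-identityˡ (remainder x k))
      (ℚ.*-monoʳ-≤-nonNeg (remainder x k) {{ℚ.nonNegative (0≤remainder k)}} 1-x≤1)

corollary3p8 :
    ∀ {ℓ : Level} (k-1 : ℕ) →
    let k = suc k-1 in
    (X : ℕ → Fin k → Set ℓ) (e : ∀ n i → Fin n ↔ X n i) →
    let p : PositiveSequence
        p n = probability (e n)
    in (∀ n .{{_ : NonZero n}} → p n ≡ 1ℚ - (1ℚ - + 1 / n) ^ k)
       × (p ≈ (λ n → + k / n) +𝒪 (λ n → (+ 1 / n) ^ 2))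
-- The constant is `k (k - 1) / 2`, and the threshold is 0 since the estimate holds for every
-- `n ≥ 1`.
corollary3p8 k-1 X e = exact , remainderBound k , 0 , λ n _ → asymptotic n
  where
  k = suc k-1

  exact : ∀ n .{{_ : NonZero n}} → probability (e n) ≡ 1ℚ - (1ℚ - + 1 / n) ^ k
  exact n = /≡1-^ (favourable (e n)) n (n ℕ.^ (k * n)) k {{it}} {{m^n≢0 n (k * n)}} (favourable-count (e n))

  asymptotic : ∀ n .{{_ : NonZero n}} →
    ∣ probability (e n) - + k / n ∣ ℚ.≤ remainderBound k ℚ.* ∣ (+ 1 / n) ^ 2 ∣
  asymptotic n = subst₂ (λ s t → s ℚ.≤ remainderBound k ℚ.* t) (sym lhs) (sym (ℚ.0≤p⇒∣p∣≡p (0≤x² 0≤x x≤1)))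
    (remainder≤ 0≤x x≤1 k)
    where
    x = + 1 / n
    0≤x : 0ℚ ℚ.≤ x
    0≤x = ℚ.nonNegative⁻¹ x {{ℚ.normalize-nonNeg 1 n}}
    x≤1 : x ℚ.≤ 1ℚ
    x≤1 = 1/≤1 n
    open +-*-Solver
    lhs : ∣ probability (e n) - + k / n ∣ ≡ remainder x k
    lhs = begin
      ∣ probability (e n) - + k / n ∣
        ≡⟨ cong₂ (λ s t → ∣ s - t ∣) (exact n) (/-as-* k n) ⟩
      ∣ 1ℚ - (1ℚ - x) ^ k - fromℕℚ k ℚ.* x ∣
        -- The deviation from `k / n` is the negative of the binomial remainder; the absolute value
        -- removes the sign.
        ≡⟨ cong ∣_∣ (solve 2 (λ y z → con 1ℚ :- y :- z := :- (y :- (con 1ℚ :- z))) refl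
             ((1ℚ - x) ^ k) (fromℕℚ k ℚ.* x)) ⟩
      ∣ ℚ.- remainder x k ∣
        ≡⟨ ℚ.∣-p∣≡∣p∣ (remainder x k) ⟩
      ∣ remainder x k ∣
        ≡⟨ ℚ.0≤p⇒∣p∣≡p (0≤remainder 0≤x x≤1 k) ⟩
      remainder x k ∎
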